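{- Let $n\ge 4$ and $s$ be integers with $2 \leq s \leq \lfloor\frac{n}{2}\rfloor$, and let $S_{n,s}$ be the spire graph. Then $$rn(S_{n,s}) = \begin{cases} 2k^2 -4k + 2s +3 & \text{if } n = 2k \text{ and } 2 \leq s \leq k-2,\\ 2k^2 -2k & \text{if } n = 2k \text{ and } s= k-1,\\ 2k^2 -2k + 1 & \text{if } n = 2k \text{ and } s= k,\\ 2k^2 -2k + 2s & \text{if } n = 2k + 1. \end{cases}$$
   Context: For a connected graph $G$, $d(u,v)$ denotes the graph distance and $\mathrm{diam}(G)$ the diameter. A radio labeling of $G$ is a function $c:V(G)\to\mathbb{Z}_{+}$ (positive integers; $0$ is not allowed) such that for all distinct $u,v\in V(G)$, $d(u,v)+|c(u)-c(v)|\ge \mathrm{diam}(G)+1$. The span of $c$ is the maximum value of $c$, and the radio number $rn(G)$ is the minimum span over all radio labelings of $G$. For integers $n\ge 4$ and $2\le s\le n-2$, the spire graph $S_{n,s}$ has vertices $v_1,\dots,v_n$ and edges $\{v_i,v_{i+1}\}$ for $i=1,\dots,n-2$ together with the edge $\{v_s,v_n\}$ (so it is the path $v_1\cdots v_{n-1}$ with a pendant vertex $v_n$ attached to $v_s$). -}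

module Defs where

open import Data.Bool using (Bool; true; false; _∧_; _∨_; T; if_then_else_)
open import Data.Bool.Properties using (T?)
open import Data.Nat using (ℕ; zero; suc; _+_; _*_; _∸_; _≤_; _⊔_; _≤ᵇ_; _≡ᵇ_; ∣_-_∣)
open import Data.Fin using (Fin; toℕ) renaming (zero to fzero; suc to fsuc)
open import Data.Fin.Properties using (any?) renaming (_≟_ to _≟ᶠ_)
open import Data.Product using (Σ; ∃; _×_; _,_)
open import Data.Sum using (_⊎_)
open import Relation.Nullary using (Dec; yes; no; ¬_)
open import Relation.Nullary.Decidable using (_⊎-dec_; _×-dec_; does)
open import Relation.Binary.PropositionalEquality using (_≡_; _≢_)

Graph : ℕ → Set
Graph n = Fin n → Fin n → Bool

module _ {n : ℕ} (G : Graph n) where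

  Reach : ℕ → Fin n → Fin n → Set
  Reach zero    u v = u ≡ v
  Reach (suc k) u v = u ≡ v ⊎ ∃ λ w → T (G u w) × Reach k w v

  reach? : ∀ k u v → Dec (Reach k u v)
  reach? zero    u v = u ≟ᶠ v
  reach? (suc k) u v = (u ≟ᶠ v) ⊎-dec any? (λ w → T? (G u w) ×-dec reach? k w v)

  -- graph distance: the least k with a walk of length ≤ k from u to v
  -- (searching k = 0 .. n; for connected graphs the distance is < n).
  distFrom : ℕ → ℕ → Fin n → Fin n → ℕ
  distFrom k zero     u v = k
  distFrom k (suc f) u v = if does (reach? k u v) then k else distFrom (suc k) f u v

  dist : Fin n → Fin n → ℕ
  dist u v = distFrom 0 n u v

maxOver : {m : ℕ} → (Fin m → ℕ) → ℕ
maxOver {zero}  f = 0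
maxOver {suc m} f = f fzero ⊔ maxOver (λ i → f (fsuc i))

diam : {n : ℕ} → Graph n → ℕ
diam G = maxOver (λ u → maxOver (λ v → dist G u v))

IsRadioLabeling : {n : ℕ} → Graph n → (Fin n → ℕ) → Set
IsRadioLabeling {n} G c =
  (∀ u → 1 ≤ c u) ×
  (∀ u v → u ≢ v → diam G + 1 ≤ dist G u v + ∣ c u - c v ∣)

span : {n : ℕ} → (Fin n → ℕ) → ℕ
span c = maxOver c

IsRadioNumber : {n : ℕ} → Graph n → ℕ → Set
IsRadioNumber {n} G m =
  (Σ (Fin n → ℕ) λ c → IsRadioLabeling G c × span c ≡ m) ×
  (∀ (c : Fin n → ℕ) → IsRadioLabeling G c → m ≤ span c)

-- Spire graph S_{n,s}: vertex v_i (1 ≤ i ≤ n) is the element of Fin n with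
-- toℕ = i - 1.  Edges: {v_i, v_{i+1}} for 1 ≤ i ≤ n-2, and {v_s, v_n}.
spireEdge : ℕ → ℕ → ℕ → ℕ → Bool
spireEdge n s a b =
  ((suc a ≡ᵇ b) ∧ (b + 2 ≤ᵇ n)) ∨ ((a ≡ᵇ s ∸ 1) ∧ (b ≡ᵇ n ∸ 1))

spire : (n s : ℕ) → Graph n
spire n s u v = spireEdge n s (toℕ u) (toℕ v) ∨ spireEdge n s (toℕ v) (toℕ u)

{-# OPTIONS --safe #-}

-- Visit the vertices in increasing order of their labels.  Consecutive labels of x and y differ by
-- at least diam + 1 − d(x, y), and d(x, y) ≤ ℓ x + ℓ y, where ℓ is the distance to the weight
-- centre v_k; summing along the order bounds the span below by a constant minus 2 Σ ℓ.  For odd n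
-- and for s = k this is attained.  For even n and s < k one measures ℓ from the central edge
-- v_{k−1} v_k instead, so that d(x, y) ≤ ℓ x + ℓ y + 1 with equality exactly across that edge.
-- Equality throughout would force the order to run between v_{k−1} and v_k and to alternate between
-- the two halves, but comparing the labels of the two neighbours of v_{n−1} shows that this vertex
-- costs at least 1 extra.  If s ≤ k − 2 then v_{n−2} costs 1 extra as well unless it is next to
-- v_{k−1}; but the endpoint v_{k−1} has a single neighbour, and v_{n−1} costs 3 extra away from it.
module Submission where

open import Defs
open import Data.Bool using (Bool; true; false; T; not; _∧_; if_then_else_)
open import Data.Bool.Properties using (T-∨; T-∧; not-involutive; ¬-not) renaming (_≟_ to _≟ᵇ_)
open import Data.Empty using (⊥)
open import Data.Fin using (Fin; toℕ; fromℕ<) renaming (zero to fzero; suc to fsuc)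
open import Data.Fin.Properties using (toℕ<n; toℕ-fromℕ<; toℕ-injective)
open import Data.List using (List; []; _∷_; length; map; allFin; tabulate)
open import Data.List.Membership.Propositional using (_∈_)
open import Data.List.Membership.Propositional.Properties using (∈-allFin)
open import Data.List.Properties using (map-tabulate; length-tabulate)
open import Data.List.Relation.Binary.Permutation.Propositional using (_↭_; ↭-sym; ↭⇒↭ₛ)
open import Data.List.Relation.Binary.Permutation.Propositional.Properties
  using (map⁺; ∈-resp-↭; ↭-length)
import Data.List.Relation.Binary.Permutation.Setoid.Properties as Permutation
import Data.List.Relation.Unary.AllPairs as AllPairs
open import Data.List.Relation.Unary.Sorted.TotalOrder.Properties using (Sorted⇒AllPairs)
open import Data.List.Relation.Unary.Unique.Propositional.Properties using (allFin⁺)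
import Data.List.Sort as Sort
open import Data.Nat
open import Data.Nat.DivMod using (m/n*n≤m)
open import Data.Nat.ListAction using (sum)
open import Data.Nat.ListAction.Properties using (sum-↭)
open import Data.Nat.Properties
open import Data.Nat.Tactic.RingSolver using (solve; solve-∀)
open import Data.Product using (Σ; ∃; _×_; _,_; proj₁; proj₂)
open import Data.Sum using (_⊎_; inj₁; inj₂)
open import Data.Unit using (⊤; tt)
open import Function using (_∘_; id)
open import Function.Bundles using (Equivalence)
open import Relation.Binary.Bundles using (DecTotalOrder)
import Relation.Binary.Construct.On as On
open import Relation.Binary.Definitions using (tri<; tri≈; tri>)
open import Relation.Binary.PropositionalEquality
open import Relation.Nullary using (¬_; yes; no; does; contradiction)
open import Relation.Nullary.Decidable using (dec-true; dec-false)

-- For even n and s < k the edge v_{k-1} v_k cuts the graph into halves of k vertices each, the left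
-- one containing v_n. Measuring from v_k alone would give the same bound as measuring from this
-- edge at extra cost 0, so the passage to the edge gains nothing by itself. What it does is to make
-- the halves symmetric and to turn every step inside a half into a visible loss of 1. The extra
-- cost has two sources: the values of ℓ at the two ends of the order, and the excesses of the
-- steps. Their total must be shown to be at least 1 for s = k - 1 and at least 2 for s ≤ k - 2. The
-- second case is the harder one, because refuting a total of 0 is not enough: a total of exactly 1
-- could come from one end off the centre or from a single step inside a half. The first possibility
-- is met by adding the unit that v_{n-1} costs anyway, the second by parity of the number of
-- vertices.

-- Farkas' rule: X ≤ Y follows from P ≤ Q once Y − X = (Q − P) + r,
-- with the subtractions cleared so that the side condition is a semiring identity.
linear : ∀ {X Y P Q} r → P ≤ Q → X + Q + r ≡ Y + P → X ≤ Y
linear {X} {Y} {P} {Q} r P≤Q eq = +-cancelʳ-≤ Q X Y (begin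
  X + Q          ≤⟨ m≤m+n (X + Q) r ⟩
  X + Q + r      ≡⟨ eq ⟩
  Y + P          ≤⟨ +-monoʳ-≤ Y P≤Q ⟩
  Y + Q          ∎)
  where open ≤-Reasoning

slack : ∀ {X Y} s → X + s ≡ Y → X ≤ Y
slack {X} s eq = m+n≤o⇒m≤o X (≤-reflexive eq)

infixl 6 _⊞_

_⊞_ : ∀ {P Q R S} → P ≤ Q → R ≤ S → P + R ≤ Q + S
_⊞_ = +-mono-≤

scale : ∀ {m n} o → m ≤ n → m * o ≤ n * o
scale o m≤n = *-monoˡ-≤ o m≤n

-- Absolute differences of natural numbers.

∣m-n∣+o≤p : ∀ {m n o p} → m + o ≤ n + p → n + o ≤ m + p → ∣ m - n ∣ + o ≤ p
∣m-n∣+o≤p {m} {n} {o} {p} h₁ h₂ with ≤-total m n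
... | inj₁ m≤n with m≤n⇒∃[o]m+o≡n m≤n
...   | d , refl rewrite ∣m-m+n∣≡n m d = linear 0 h₂ (solve (m ∷ d ∷ o ∷ p ∷ []))
∣m-n∣+o≤p {m} {n} {o} {p} h₁ h₂ | inj₂ n≤m with m≤n⇒∃[o]m+o≡n n≤m
... | d , refl rewrite ∣-∣-comm (n + d) n | ∣m-m+n∣≡n n d = linear 0 h₁ (solve (n ∷ d ∷ o ∷ p ∷ []))

∣m-n∣≤m+n : ∀ m n → ∣ m - n ∣ ≤ m + n
∣m-n∣≤m+n m n = ≤-trans (∣m-n∣≤m⊔n m n) (m⊔n≤m+n m n)

-- Both points are joined to (`y` , 0). This is the source of every bound of a distance by
-- `ℓ u + ℓ v`.
ℓ¹-triangle : ∀ x x′ y h h′ → ∣ x - x′ ∣ + ∣ h - h′ ∣ ≤ ∣ x - y ∣ + h + (∣ x′ - y ∣ + h′)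
ℓ¹-triangle x x′ y h h′ = linear 0
  (∣-∣-triangle x y x′ ⊞ ≤-reflexive (∣-∣-comm y x′) ⊞ ∣m-n∣≤m+n h h′)
  (regroup ∣ x - x′ ∣ ∣ x - y ∣ ∣ y - x′ ∣ ∣ x′ - y ∣ ∣ h - h′ ∣ h h′)
  where
  regroup : ∀ d a b b′ e p q → d + e + (a + b + b′ + (p + q)) + 0 ≡ a + p + (b′ + q) + (d + b + e)
  regroup = solve-∀

∣m+n-m∣≡n : ∀ m n → ∣ m + n - m ∣ ≡ n
∣m+n-m∣≡n m n = trans (∣-∣-comm (m + n) m) (∣m-m+n∣≡n m n)

m≤n⇒∣m-n∣+m≡n : ∀ {m n} → m ≤ n → ∣ m - n ∣ + m ≡ n
m≤n⇒∣m-n∣+m≡n {m} m≤n = trans (cong (_+ m) (m≤n⇒∣m-n∣≡n∸m m≤n)) (m∸n+n≡m m≤n)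

m<n⇒∣m-n∣≡1+∣1+m-n∣ : ∀ {m n} → m < n → ∣ m - n ∣ ≡ suc ∣ suc m - n ∣
m<n⇒∣m-n∣≡1+∣1+m-n∣ {zero}  {suc n} _         = refl
m<n⇒∣m-n∣≡1+∣1+m-n∣ {suc m} {suc n} (s≤s m<n) = m<n⇒∣m-n∣≡1+∣1+m-n∣ m<n

n≤m⇒∣1+m-n∣≡1+∣m-n∣ : ∀ {m n} → n ≤ m → ∣ suc m - n ∣ ≡ suc ∣ m - n ∣
n≤m⇒∣1+m-n∣≡1+∣m-n∣ {m}     {zero}  _         = cong suc (sym (∣-∣-identityʳ m))
n≤m⇒∣1+m-n∣≡1+∣m-n∣ {suc m} {suc n} (s≤s n≤m) = n≤m⇒∣1+m-n∣≡1+∣m-n∣ n≤m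

-- Finite maxima, and the graph distance as a least walk length.

maxOver-< : ∀ {m B} {f : Fin m → ℕ} → 0 < B → (∀ i → f i < B) → maxOver f < B
maxOver-< {zero}  0<B f<B = 0<B
maxOver-< {suc m} 0<B f<B = ⊔-pres-<m (f<B fzero) (maxOver-< 0<B (f<B ∘ fsuc))

≤maxOver : ∀ {m} (f : Fin m → ℕ) i → f i ≤ maxOver f
≤maxOver f fzero    = m≤m⊔n (f fzero) _
≤maxOver f (fsuc i) = m≤n⇒m≤o⊔n (f fzero) (≤maxOver (f ∘ fsuc) i)

module _ {n} (G : Graph n) where

  -- The invariant `k ≤ d ≤ k + f` says that the search has neither passed `d` nor too little fuel
  -- to get there. When the fuel is gone it forces `k ≡ d`, so even the default value is the right
  -- one.
  distFrom-least : ∀ {d u v} → (∀ {l} → Reach G l u v → d ≤ l) → Reach G d u v →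
                   ∀ k f → k ≤ d → d ≤ k + f → distFrom G k f u v ≡ d
  distFrom-least d-min r k zero k≤d d≤k+0 = ≤-antisym k≤d (subst (_ ≤_) (+-identityʳ k) d≤k+0)
  distFrom-least {d} {u} {v} d-min r k (suc f) k≤d d≤k+f with reach? G k u v
  ... | yes r′ = ≤-antisym k≤d (d-min r′)
  ... | no ¬r  = distFrom-least d-min r (suc k) f
    (≤∧≢⇒< k≤d (λ { refl → ¬r r })) (subst (d ≤_) (+-suc k f) d≤k+f)

-- The spire graph with spine 0, …, m − 1 and the tip m attached to t.  Sending the spine
-- vertex x to (x , 0) and the tip to (t , 1) turns the graph distance into the ℓ¹ distance.
module Spire (m t : ℕ) (1≤t : 1 ≤ t) (t+2≤m : t + 2 ≤ m) where

  V : Set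
  V = Fin (suc m)

  S : Graph (suc m)
  S = spire (suc m) (suc t)

  t<m : t < m
  t<m = linear 1 t+2≤m (solve (t ∷ m ∷ []))

  data Adjacent (a b : ℕ) : Set where
    along  : suc a ≡ b → b < m → Adjacent a b
    attach : a ≡ t → b ≡ m → Adjacent a b

  spireEdge⇒Adjacent : ∀ a b → T (spireEdge (suc m) (suc t) a b) → Adjacent a b
  spireEdge⇒Adjacent a b e with Equivalence.to T-∨ e
  ... | inj₁ e₁ = let (p , q) = Equivalence.to T-∧ e₁ in
    along (≡ᵇ⇒≡ (suc a) b p) (linear 0 (≤ᵇ⇒≤ (b + 2) (suc m) q) (solve (b ∷ m ∷ [])))
  ... | inj₂ e₂ = let (p , q) = Equivalence.to T-∧ e₂ in
    attach (≡ᵇ⇒≡ a t p) (≡ᵇ⇒≡ b m q)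

  Adjacent⇒spireEdge : ∀ {a b} → Adjacent a b → T (spireEdge (suc m) (suc t) a b)
  Adjacent⇒spireEdge {a} {b} (along p q) = Equivalence.from T-∨ (inj₁ (Equivalence.from T-∧
    (≡⇒≡ᵇ (suc a) b p , ≤⇒≤ᵇ {b + 2} {suc m} (linear 0 q (solve (b ∷ m ∷ []))))))
  Adjacent⇒spireEdge {a} {b} (attach p q) = Equivalence.from
    (T-∨ {spineEdge}) (inj₂ (Equivalence.from T-∧ (≡⇒≡ᵇ a t p , ≡⇒≡ᵇ b m q)))
    where
    spineEdge : Bool
    spineEdge = (suc a ≡ᵇ b) ∧ (b + 2 ≤ᵇ suc m)

  -- Defined on indices rather than on vertices, so that a sum over all vertices turns into a sum
  -- over an initial segment of the naturals.
  xcoord hcoord : ℕ → ℕ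
  xcoord i = if does (i ≟ m) then t else i
  hcoord i = if does (i ≟ m) then 1 else 0

  xcoord-spine : ∀ {i} → i ≢ m → xcoord i ≡ i
  xcoord-spine {i} i≢m rewrite dec-false (i ≟ m) i≢m = refl

  hcoord-spine : ∀ {i} → i ≢ m → hcoord i ≡ 0
  hcoord-spine {i} i≢m rewrite dec-false (i ≟ m) i≢m = refl

  xcoord-tip : ∀ {i} → i ≡ m → xcoord i ≡ t
  xcoord-tip {i} i≡m rewrite dec-true (i ≟ m) i≡m = refl

  hcoord-tip : ∀ {i} → i ≡ m → hcoord i ≡ 1
  hcoord-tip {i} i≡m rewrite dec-true (i ≟ m) i≡m = refl

  X H : V → ℕ
  X u = xcoord (toℕ u)
  H u = hcoord (toℕ u)

  δ : V → V → ℕ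
  δ u v = ∣ X u - X v ∣ + ∣ H u - H v ∣

  data Kind (u : V) : Set where
    spine : toℕ u < m → X u ≡ toℕ u → H u ≡ 0 → Kind u
    tip   : toℕ u ≡ m → X u ≡ t → H u ≡ 1 → Kind u

  kind : ∀ u → Kind u
  kind u with toℕ u ≟ m
  ... | yes u≡m = tip u≡m (xcoord-tip u≡m) (hcoord-tip u≡m)
  ... | no u≢m = spine (≤∧≢⇒< (s≤s⁻¹ (toℕ<n u)) u≢m) (xcoord-spine u≢m) (hcoord-spine u≢m)

  X<m : ∀ u → X u < m
  X<m u with kind u
  ... | spine u<m X≡u _ = subst (_< m) (sym X≡u) u<m
  ... | tip _ X≡t _     = subst (_< m) (sym X≡t) t<m

  vertex : ∀ {x} → x < m → Σ V λ u → toℕ u ≡ x × X u ≡ x × H u ≡ 0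
  vertex {x} x<m = u , u≡x , trans (xcoord-spine u≢m) u≡x , hcoord-spine u≢m
    where
    u   = fromℕ< (m<n⇒m<1+n x<m)
    u≡x = toℕ-fromℕ< (m<n⇒m<1+n x<m)
    u≢m : toℕ u ≢ m
    u≢m u≡m = <⇒≢ x<m (trans (sym u≡x) u≡m)

  XH-injective : ∀ {u v} → X u ≡ X v → H u ≡ H v → u ≡ v
  XH-injective {u} {v} Xu≡Xv Hu≡Hv with kind u | kind v
  ... | spine _ Xu _ | spine _ Xv _ = toℕ-injective (trans (sym Xu) (trans Xu≡Xv Xv))
  ... | tip u≡m _ _  | tip v≡m _ _  = toℕ-injective (trans u≡m (sym v≡m))
  ... | spine _ _ Hu | tip _ _ Hv   = contradiction (trans (sym Hu) (trans Hu≡Hv Hv)) λ ()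
  ... | tip _ _ Hu   | spine _ _ Hv = contradiction (trans (sym Hv) (trans (sym Hu≡Hv) Hu)) λ ()

  δ-refl : ∀ u → δ u u ≡ 0
  δ-refl u = cong₂ _+_ (∣n-n∣≡0 (X u)) (∣n-n∣≡0 (H u))

  δ≡0⇒≡ : ∀ {u v} → δ u v ≡ 0 → u ≡ v
  δ≡0⇒≡ {u} {v} δ≡0 = XH-injective
    (∣m-n∣≡0⇒m≡n (m+n≡0⇒m≡0 _ δ≡0)) (∣m-n∣≡0⇒m≡n (m+n≡0⇒n≡0 ∣ X u - X v ∣ δ≡0))

  δ-sym : ∀ u v → δ u v ≡ δ v u
  δ-sym u v = cong₂ _+_ (∣-∣-comm (X u) (X v)) (∣-∣-comm (H u) (H v))

  δ-triangle : ∀ u v w → δ u w ≤ δ u v + δ v w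
  δ-triangle u v w = linear 0 (∣-∣-triangle (X u) (X v) (X w) ⊞ ∣-∣-triangle (H u) (H v) (H w))
    (regroup ∣ X u - X w ∣ ∣ X u - X v ∣ ∣ X v - X w ∣ ∣ H u - H w ∣ ∣ H u - H v ∣ ∣ H v - H w ∣)
    where
    regroup : ∀ a b c d e f → a + d + (b + c + (e + f)) + 0 ≡ b + e + (c + f) + (a + d)
    regroup = solve-∀

  Adjacent⇒δ≤1 : ∀ {u v} → Adjacent (toℕ u) (toℕ v) → δ u v ≤ 1
  Adjacent⇒δ≤1 {u} {v} (along 1+u≡v v<m) with kind u | kind v
  ... | tip u≡m _ _ | _ = contradiction (≤-trans (≤-reflexive 1+u≡v) (<⇒≤ v<m))
                           (<⇒≱ (s≤s (≤-reflexive (sym u≡m))))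
  ... | _ | tip v≡m _ _ = contradiction v≡m (<⇒≢ v<m)
  ... | spine _ Xu Hu | spine _ Xv Hv
    rewrite Xu | Hu | Xv | Hv | sym 1+u≡v | m<n⇒∣m-n∣≡1+∣1+m-n∣ (n<1+n (toℕ u)) | ∣n-n∣≡0 (toℕ u)
    = ≤-refl
  Adjacent⇒δ≤1 {u} {v} (attach u≡t v≡m) with kind u | kind v
  ... | tip u≡m _ _ | _ = contradiction (trans (sym u≡t) u≡m) (<⇒≢ t<m)
  ... | _ | spine v<m _ _ = contradiction v≡m (<⇒≢ v<m)
  ... | spine _ Xu Hu | tip _ Xv Hv
    rewrite Xu | Hu | Xv | Hv | u≡t | ∣n-n∣≡0 t = ≤-refl

  edge⇒δ≤1 : ∀ u v → T (S u v) → δ u v ≤ 1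
  edge⇒δ≤1 u v e with Equivalence.to T-∨ e
  ... | inj₁ uv = Adjacent⇒δ≤1 (spireEdge⇒Adjacent (toℕ u) (toℕ v) uv)
  ... | inj₂ vu = subst (_≤ 1) (δ-sym v u) (Adjacent⇒δ≤1 (spireEdge⇒Adjacent (toℕ v) (toℕ u) vu))

  Reach⇒δ≤ : ∀ l {u v} → Reach S l u v → δ u v ≤ l
  Reach⇒δ≤ zero    {u} refl        = ≤-reflexive (δ-refl u)
  Reach⇒δ≤ (suc l) {u} (inj₁ refl) = subst (_≤ suc l) (sym (δ-refl u)) z≤n
  Reach⇒δ≤ (suc l) {u} {v} (inj₂ (w , e , r)) =
    ≤-trans (δ-triangle u w v) (edge⇒δ≤1 u w e ⊞ Reach⇒δ≤ l r)

  forward : ∀ u v → Adjacent (toℕ u) (toℕ v) → T (S u v)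
  forward u v = Equivalence.from T-∨ ∘ inj₁ ∘ Adjacent⇒spireEdge

  backward : ∀ u v → Adjacent (toℕ v) (toℕ u) → T (S u v)
  backward u v = Equivalence.from (T-∨ {spireEdge (suc m) (suc t) (toℕ u) (toℕ v)})
    ∘ inj₂ ∘ Adjacent⇒spireEdge

  -- The tip moves down to `t`, and a spine vertex moves horizontally towards `X v`. A spine vertex
  -- already in the column of `v` is `v` itself or is joined to it by the pendant edge.
  step : ∀ {u v l} → δ u v ≤ suc l → u ≡ v ⊎ ∃ λ w → T (S u w) × δ w v ≤ l
  step {u} {v} {l} δ≤ with kind u | kind v
  ... | tip u≡m _ _ | tip v≡m _ _ = inj₁ (toℕ-injective (trans u≡m (sym v≡m)))
  ... | tip u≡m Xu Hu | spine _ Xv Hv with vertex t<m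
  ...   | w , w≡t , Xw , Hw = inj₂ (w , backward u w (attach w≡t u≡m) , δwv)
    where
    δwv : δ w v ≤ l
    δwv rewrite Xu | Hu | Hv | Xw | Hw = s≤s⁻¹ (subst (_≤ suc l) (shift ∣ t - X v ∣) δ≤)
      where shift : ∀ a → a + 1 ≡ suc (a + 0)
            shift = solve-∀
  step {u} {v} {l} δ≤ | spine u<m Xu Hu | _ with <-cmp (toℕ u) (X v)
  ... | tri< u<Xv _ _ with vertex (≤-<-trans u<Xv (X<m v))
  ...   | w , w≡1+u , Xw , Hw = inj₂
    (w , forward u w (along (sym w≡1+u) (subst (_< m) (sym w≡1+u) (≤-<-trans u<Xv (X<m v)))) , δwv)
    where
    δwv : δ w v ≤ l
    δwv rewrite Xu | Hu | Xw | Hw | m<n⇒∣m-n∣≡1+∣1+m-n∣ u<Xv = s≤s⁻¹ δ≤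
  step {u} {v} {l} δ≤ | spine u<m Xu Hu | _ | tri> _ _ Xv<u = back (toℕ u) refl Xv<u
    where
    back : ∀ x → toℕ u ≡ x → X v < x → u ≡ v ⊎ ∃ λ w → T (S u w) × δ w v ≤ l
    back (suc x) u≡1+x (s≤s Xv≤x) with vertex (<-trans (n<1+n x) (subst (_< m) u≡1+x u<m))
    ... | w , w≡x , Xw , Hw = inj₂
      (w , backward u w (along (trans (cong suc w≡x) (sym u≡1+x)) u<m) , δwv)
      where
      δwv : δ w v ≤ l
      δwv rewrite Xu | Hu | Xw | Hw | u≡1+x | n≤m⇒∣1+m-n∣≡1+∣m-n∣ Xv≤x = s≤s⁻¹ δ≤
  step {u} {v} {l} δ≤ | spine u<m Xu Hu | kv | tri≈ _ u≡Xv _ with kv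
  ... | spine _ Xv Hv = inj₁ (toℕ-injective (trans u≡Xv Xv))
  ... | tip v≡m Xv Hv = inj₂ (v , forward u v (attach (trans u≡Xv Xv) v≡m) ,
                              subst (_≤ l) (sym (δ-refl v)) z≤n)

  δ≤⇒Reach : ∀ l {u v} → δ u v ≤ l → Reach S l u v
  δ≤⇒Reach zero    δ≤0 = δ≡0⇒≡ (n≤0⇒n≡0 δ≤0)
  δ≤⇒Reach (suc l) {u} {v} δ≤ with step {u} {v} δ≤
  ... | inj₁ u≡v            = inj₁ u≡v
  ... | inj₂ (w , e , δwv≤) = inj₂ (w , e , δ≤⇒Reach l δwv≤)

  0<m : 0 < m
  0<m = ≤-<-trans z≤n t<m

  -- The tip does not enlarge the diameter because it is not attached to an end of the spine:
  -- `t + 2 ≤ m` controls its distance to the left end, `1 ≤ t` that to the right end.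
  ∣t-x∣+1<m : ∀ {x} → x < m → ∣ t - x ∣ + 1 < m
  ∣t-x∣+1<m {x} x<m = subst (_≤ m) (+-suc ∣ t - x ∣ 1) (∣m-n∣+o≤p {t} {x} {2} {m}
    (m≤n⇒m≤o+n x t+2≤m) (linear 0 (1≤t ⊞ x<m) (solve (t ∷ x ∷ m ∷ []))))

  δ<m : ∀ u v → δ u v < m
  δ<m u v with kind u | kind v
  ... | spine u<m Xu Hu | spine v<m Xv Hv rewrite Xu | Hu | Xv | Hv =
    subst (_< m) (sym (+-identityʳ _)) (≤-<-trans (∣m-n∣≤m⊔n (toℕ u) (toℕ v)) (⊔-pres-<m u<m v<m))
  ... | tip u≡m Xu Hu | tip v≡m Xv Hv rewrite Xu | Hu | Xv | Hv | ∣n-n∣≡0 t = 0<m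
  ... | spine u<m Xu Hu | tip v≡m Xv Hv rewrite Xu | Hu | Xv | Hv | ∣-∣-comm (toℕ u) t =
    ∣t-x∣+1<m u<m
  ... | tip u≡m Xu Hu | spine v<m Xv Hv rewrite Xu | Hu | Xv | Hv = ∣t-x∣+1<m v<m

  dist≡δ : ∀ u v → dist S u v ≡ δ u v
  dist≡δ u v = distFrom-least S (Reach⇒δ≤ _) (δ≤⇒Reach _ ≤-refl) 0 (suc m) z≤n
    (<⇒≤ (m<n⇒m<1+n (δ<m u v)))

  -- The two ends of the spine attain the bound of `δ<m`.
  diam+1≡m : diam S + 1 ≡ m
  diam+1≡m = trans (+-comm (diam S) 1) (≤-antisym
    (maxOver-< 0<m λ u → maxOver-< 0<m λ v → subst (_< m) (sym (dist≡δ u v)) (δ<m u v))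
    (go m refl))
    where
    go : ∀ l → m ≡ l → m ≤ suc (diam S)
    go zero    m≡0 = subst (_≤ suc (diam S)) (sym m≡0) z≤n
    go (suc l) m≡1+l with vertex 0<m | vertex (≤-reflexive (sym m≡1+l))
    ... | u , _ , Xu , Hu | v , _ , Xv , Hv =
      ≤-trans (≤-reflexive m≡1+l) (s≤s (begin
        l                                ≡⟨ duv ⟨
        dist S u v                       ≤⟨ ≤maxOver (dist S u) v ⟩
        maxOver (dist S u)               ≤⟨ ≤maxOver (λ u → maxOver (dist S u)) u ⟩
        diam S                           ∎))
      where
      open ≤-Reasoning
      duv : dist S u v ≡ l
      duv = trans (dist≡δ u v) δuv
        where
        δuv : δ u v ≡ l
        δuv rewrite Xu | Xv | Hu | Hv = +-identityʳ l

-- Labellings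

-- R x h l says that the vertex with coordinates (x , h) receives the label l.
Labels : Set₁
Labels = ℕ → ℕ → ℕ → Set

module Labelling (m : ℕ) where

  -- A record, so that unification can recover the coordinates; the bare inequality would not
  -- determine them.
  record Apart (x h l x′ h′ l′ : ℕ) : Set where
    constructor apart
    field separation : ¬ (x ≡ x′ × h ≡ h′) → m ≤ ∣ x - x′ ∣ + ∣ h - h′ ∣ + ∣ l - l′ ∣

  record Compatible (R R′ : Labels) : Set where
    constructor compat
    field apartness : ∀ {x h l x′ h′ l′} → R x h l → R′ x′ h′ l′ → Apart x h l x′ h′ l′

  open Compatible public

  Apart-sym : ∀ {x h l x′ h′ l′} → Apart x h l x′ h′ l′ → Apart x′ h′ l′ x h l
  Apart-sym {x} {h} {l} {x′} {h′} {l′} (apart separation) = apart swapped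
    where
    swapped : ¬ (x′ ≡ x × h′ ≡ h) → m ≤ ∣ x′ - x ∣ + ∣ h′ - h ∣ + ∣ l′ - l ∣
    swapped distinct rewrite ∣-∣-comm x′ x | ∣-∣-comm h′ h | ∣-∣-comm l′ l =
      separation λ { (refl , refl) → distinct (refl , refl) }

  -- An absolute value is at least the signed difference, so no order of the positions or labels has
  -- to be assumed: the signs `x′ - x` and `l′ - l` are simply chosen.
  rightward : ∀ {x h l x′ h′ l′} → m + l + x ≤ l′ + x′ + ∣ h - h′ ∣ → Apart x h l x′ h′ l′
  rightward {x} {h} {l} {x′} {h′} {l′} hyp = apart λ _ →
    linear 0 (hyp ⊞ m≤n+∣n-m∣ x′ x ⊞ m≤n+∣n-m∣ l′ l)
      (regroup ∣ x - x′ ∣ ∣ h - h′ ∣ ∣ l - l′ ∣ x x′ l l′ m)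
    where
    regroup : ∀ a b c x x′ l l′ m → m + (l′ + x′ + b + (x + a) + (l + c)) + 0
                                    ≡ a + b + c + (m + l + x + x′ + l′)
    regroup = solve-∀

  leftward : ∀ {x h l x′ h′ l′} → m + l + x′ ≤ l′ + x + ∣ h - h′ ∣ → Apart x h l x′ h′ l′
  leftward {x} {h} {l} {x′} {h′} {l′} hyp = apart λ _ →
    linear 0 (hyp ⊞ m≤n+∣m-n∣ x x′ ⊞ m≤n+∣n-m∣ l′ l)
      (regroup ∣ x - x′ ∣ ∣ h - h′ ∣ ∣ l - l′ ∣ x x′ l l′ m)
    where
    regroup : ∀ a b c x x′ l l′ m → m + (l′ + x + b + (x′ + a) + (l + c)) + 0
                                    ≡ a + b + c + (m + l + x′ + x + l′)
    regroup = solve-∀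

  -- Distinct vertices are at distance at least 1, so labels that differ by `m - 1` need no look at
  -- the positions.
  far : ∀ {x h l x′ h′ l′} → m + l ≤ suc l′ → Apart x h l x′ h′ l′
  far {x} {h} {l} {x′} {h′} {l′} hyp = apart λ distinct →
    linear 0 (hyp ⊞ m≤n+∣n-m∣ l′ l ⊞ n≢0⇒n>0 (d≢0 distinct))
      (regroup (∣ x - x′ ∣ + ∣ h - h′ ∣) ∣ l - l′ ∣ l l′ m)
    where
    d≢0 : ¬ (x ≡ x′ × h ≡ h′) → ∣ x - x′ ∣ + ∣ h - h′ ∣ ≢ 0
    d≢0 distinct d≡0 = distinct
      (∣m-n∣≡0⇒m≡n (m+n≡0⇒m≡0 _ d≡0) , ∣m-n∣≡0⇒m≡n (m+n≡0⇒n≡0 ∣ x - x′ ∣ d≡0))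
    regroup : ∀ d c l l′ m → m + (suc l′ + (l + c) + d) + 0 ≡ d + c + (m + l + l′ + 1)
    regroup = solve-∀

  ⋃ : List Labels → Labels
  ⋃ []       x h l = ⊥
  ⋃ (R ∷ Rs) x h l = R x h l ⊎ ⋃ Rs x h l

  Against : Labels → List Labels → Set
  Against R []        = ⊤
  Against R (R′ ∷ Rs) = Compatible R R′ × Against R Rs

  Pairwise : List Labels → Set
  Pairwise []       = ⊤
  Pairwise (R ∷ Rs) = Compatible R R × Against R Rs × Pairwise Rs

  ⋃-against : ∀ {R} Rs → Against R Rs → Compatible R (⋃ Rs)
  ⋃-against (R′ ∷ Rs) (c , cs) .apartness r (inj₁ r′) = c .apartness r r′
  ⋃-against (R′ ∷ Rs) (c , cs) .apartness r (inj₂ p′) = ⋃-against Rs cs .apartness r p′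
  ⋃-against []        _        .apartness r ()

  ⋃-compatible : ∀ Rs → Pairwise Rs → Compatible (⋃ Rs) (⋃ Rs)
  ⋃-compatible []       _            .apartness ()
  ⋃-compatible (R ∷ Rs) (c , a , cs) .apartness (inj₁ r) (inj₁ r′) = c .apartness r r′
  ⋃-compatible (R ∷ Rs) (c , a , cs) .apartness (inj₁ r) (inj₂ p′) = ⋃-against Rs a .apartness r p′
  ⋃-compatible (R ∷ Rs) (c , a , cs) .apartness (inj₂ p) (inj₁ r′) =
    Apart-sym (⋃-against Rs a .apartness r′ p)
  ⋃-compatible (R ∷ Rs) (c , a , cs) .apartness (inj₂ p) (inj₂ p′) =
    ⋃-compatible Rs cs .apartness p p′

  data At (x h l : ℕ) : Labels where
    at : At x h l x h l

  At-compatible : ∀ {x h l} → Compatible (At x h l) (At x h l)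
  At-compatible .apartness at at = apart λ distinct → contradiction (refl , refl) distinct

  -- `P` relates position and index instead of computing one from the other; decreasing runs then
  -- need no truncated subtraction.
  data Progression (P : ℕ → ℕ → Set) (α w : ℕ) : Labels where
    term : ∀ {x} i → P x i → Progression P α w x 0 (α + i * w)

  module _ {P : ℕ → ℕ → Set} {α w : ℕ} (m≤1+w : m ≤ suc w) where

    Progression-compatible : (∀ {x x′ i} → P x i → P x′ i → x ≡ x′) →
                             Compatible (Progression P α w) (Progression P α w)
    Progression-compatible inj .apartness (term i p) (term i′ p′) with <-cmp i i′
    ... | tri≈ _ refl _ = apart λ distinct → contradiction (inj p p′ , refl) distinct
    ... | tri< i<i′ _ _ with m≤n⇒∃[o]m+o≡n i<i′
    ...   | r , refl = far (linear (r * w) m≤1+w (solve (m ∷ α ∷ w ∷ i ∷ r ∷ [])))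
    Progression-compatible inj .apartness (term i p) (term i′ p′) | tri> _ _ i′<i
      with m≤n⇒∃[o]m+o≡n i′<i
    ... | r , refl = Apart-sym (far (linear (r * w) m≤1+w (solve (m ∷ α ∷ w ∷ i′ ∷ r ∷ []))))

    -- The labels interleave as P, Q, P, Q, ... with period `w`. Labels that are not consecutive in
    -- this pattern differ by at least `w`, hence by `m - 1`, and are `far`; only the two kinds of
    -- consecutive pairs depend on positions.
    alternating : ∀ {Q : ℕ → ℕ → Set} {β} → α ≤ β → β ≤ α + w →
      (∀ {i x x′} → P x i → Q x′ i → Apart x 0 (α + i * w) x′ 0 (β + i * w)) →
      (∀ {i x x′} → Q x i → P x′ (suc i) → Apart x 0 (β + i * w) x′ 0 (α + suc i * w)) →
      Compatible (Progression P α w) (Progression Q β w)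
    alternating {Q} {β} α≤β β≤α+w same next .apartness (term i p) (term i′ q) with <-cmp i i′
    ... | tri≈ _ refl _ = same p q
    ... | tri< i<i′ _ _ with m≤n⇒∃[o]m+o≡n i<i′
    ...   | r , refl = far (linear (r * w) (m≤1+w ⊞ α≤β) (solve (m ∷ α ∷ β ∷ w ∷ i ∷ r ∷ [])))
    alternating {Q} {β} α≤β β≤α+w same next .apartness (term i p) (term i′ q) | tri> _ _ i′<i
      with m≤n⇒∃[o]m+o≡n i′<i
    ... | zero  , refl rewrite +-identityʳ i′ = Apart-sym (next q p)
    ... | suc r , refl = Apart-sym
      (far (linear (r * w) (m≤1+w ⊞ β≤α+w) (solve (m ∷ α ∷ β ∷ w ∷ i′ ∷ r ∷ []))))

  record Valid (t M : ℕ) (Rs : List Labels) : Set where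
    field
      compatible : Compatible (⋃ Rs) (⋃ Rs)
      covering   : ∀ {x} → x < m → ∃ λ l → ⋃ Rs x 0 l
      tip-label  : ∃ λ l → ⋃ Rs t 1 l
      bounded    : ∀ {x h l} → ⋃ Rs x h l → 1 ≤ l × l ≤ M

-- n = 2k + 1 with k = 1 + j.  The visiting order is
-- v_{k−1}, v_{2k−1}, v_{k−2}, v_{2k−2}, …, v_1, v_{k+1}, v_n, v_{2k}, v_k, without excess.
module OddLabelling (j t : ℕ) (1≤t : 1 ≤ t) (t≤j : t ≤ j) where

  open Labelling (2 * j + 2)

  Left Right : ℕ → ℕ → Set
  Left  x i = x + i + 1 ≡ j × i < j
  Right x i = x + i ≡ 2 * j × i < j

  labels : List Labels
  -- Without excess a label exceeds its predecessor by `m` minus the distance. The jumps to the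
  -- right have length `j + 1` and those back `j + 2`, so the increments are `j + 1` and `j`, with
  -- period `1 + 2 * j`.
  labels = Progression Left 1 (1 + 2 * j)
         ∷ Progression Right (2 + j) (1 + 2 * j)
         ∷ At t 1 (1 + j * (1 + 2 * j) + t)
         ∷ At (1 + 2 * j) 0 (1 + j * (1 + 2 * j) + 2 * t)
         ∷ At j 0 (2 + j + j * (1 + 2 * j) + 2 * t)
         ∷ []

  m≤1+w : 2 * j + 2 ≤ suc (1 + 2 * j)
  m≤1+w = slack 0 (solve (j ∷ []))

  compatible : Compatible (⋃ labels) (⋃ labels)
  compatible = ⋃-compatible labels
    ( Progression-compatible m≤1+w (λ {x} {x′} {i} (e , _) (e′ , _) →
        +-cancelʳ-≡ i x x′ (+-cancelʳ-≡ 1 (x + i) (x′ + i) (trans e (sym e′))))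
      , ( alternating m≤1+w (slack (1 + j) (solve (j ∷ []))) (slack j (solve (j ∷ [])))
          (λ {i} {x} {x′} (e , _) (e′ , _) → rightward
            (linear 0 (≤-reflexive e ⊞ ≤-reflexive (sym e′)) (solve (j ∷ i ∷ x ∷ x′ ∷ []))))
          (λ {i} {x} {x′} (e , _) (e′ , _) → leftward
            (linear 0 (≤-reflexive (sym e) ⊞ ≤-reflexive e′) (solve (j ∷ i ∷ x ∷ x′ ∷ []))))
        , (compat λ { (term i (_ , i<j)) at →
           far (linear 1 (scale (1 + 2 * j) i<j ⊞ 1≤t) (solve (j ∷ t ∷ i ∷ []))) })
        , (compat λ { (term i (_ , i<j)) at →
           far (linear (1 + t) (scale (1 + 2 * j) i<j ⊞ 1≤t) (solve (j ∷ t ∷ i ∷ []))) })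
        , (compat λ { (term i (_ , i<j)) at →
           far (linear (1 + j + 2 * t) (scale (1 + 2 * j) i<j) (solve (j ∷ t ∷ i ∷ []))) })
        , tt)
    , Progression-compatible m≤1+w (λ {x} {x′} {i} (e , _) (e′ , _) →
        +-cancelʳ-≡ i x x′ (trans e (sym e′)))
      , ( (compat λ { (term {x} i (e , i<j)) at →
           leftward (linear 0 (scale (1 + 2 * j) i<j ⊞ ≤-reflexive (sym e) ⊞ i<j)
             (solve (j ∷ t ∷ i ∷ x ∷ []))) })
        , (compat λ { (term {x} i (e , i<j)) at →
           rightward (linear 0 (scale (2 * j) i<j ⊞ ≤-reflexive e ⊞ 1≤t ⊞ 1≤t)
             (solve (j ∷ t ∷ i ∷ x ∷ []))) })
        , (compat λ { (term i (_ , i<j)) at →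
           far (linear (2 * t) (scale (1 + 2 * j) i<j) (solve (j ∷ t ∷ i ∷ []))) })
        , tt)
    , At-compatible
      , ( (compat λ { at at → rightward (slack 0 (solve (j ∷ t ∷ []))) })
        , (compat λ { at at → rightward (slack 0 (solve (j ∷ t ∷ []))) })
        , tt)
    , At-compatible
      , ( (compat λ { at at → leftward (slack 0 (solve (j ∷ t ∷ []))) })
        , tt)
    , At-compatible
      , tt
    , tt)

  covering : ∀ {x} → x < 2 * j + 2 → ∃ λ l → ⋃ labels x 0 l
  covering {x} x<m with <-cmp x j
  ... | tri≈ _ refl _ = _ , inj₂ (inj₂ (inj₂ (inj₂ (inj₁ at))))
  ... | tri< x<j _ _ with m≤n⇒∃[o]m+o≡n x<j
  ...   | i , 1+x+i≡j = _ , inj₁ (term i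
    (trans (+-comm (x + i) 1) 1+x+i≡j , linear x (≤-reflexive 1+x+i≡j) (solve (x ∷ i ∷ j ∷ []))))
  covering {x} x<m | tri> _ _ j<x
    with m≤n⇒m<n∨m≡n {x} {1 + 2 * j} (linear 0 x<m (solve (x ∷ j ∷ [])))
  ... | inj₂ refl = _ , inj₂ (inj₂ (inj₂ (inj₁ at)))
  ... | inj₁ (s≤s x≤2j) with m≤n⇒∃[o]m+o≡n x≤2j
  ...   | i , x+i≡2j = _ , inj₂ (inj₁ (term i
    (x+i≡2j , linear 0 (j<x ⊞ ≤-reflexive x+i≡2j) (solve (x ∷ i ∷ j ∷ [])))))

  valid : Valid t (2 + j + j * (1 + 2 * j) + 2 * t) labels
  valid = record
    { compatible = compatible
    ; covering   = covering
    ; tip-label  = _ , inj₂ (inj₂ (inj₁ at))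
    ; bounded    = λ
      { (inj₁ (term i (_ , i<j))) →
          s≤s z≤n , linear (2 + 3 * j + 2 * t) (scale (1 + 2 * j) i<j) (solve (j ∷ t ∷ i ∷ []))
      ; (inj₂ (inj₁ (term i (_ , i<j)))) →
          s≤s z≤n , linear (1 + 2 * j + 2 * t) (scale (1 + 2 * j) i<j) (solve (j ∷ t ∷ i ∷ []))
      ; (inj₂ (inj₂ (inj₁ at))) →
          s≤s z≤n , slack (1 + j + t) (solve (j ∷ t ∷ []))
      ; (inj₂ (inj₂ (inj₂ (inj₁ at)))) →
          s≤s z≤n , slack (1 + j) (solve (j ∷ t ∷ []))
      ; (inj₂ (inj₂ (inj₂ (inj₂ (inj₁ at))))) →
          s≤s z≤n , ≤-refl
      }
    }

-- n = 2k and s = k with k = 1 + j.  The visiting order is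
-- v_k, v_1, v_{k+1}, v_2, v_{k+2}, …, v_{k−1}, v_{2k−1}, v_n, without excess.
module CentralLabelling (j : ℕ) (1≤j : 1 ≤ j) where

  open Labelling (2 * j + 1)

  Left Right : ℕ → ℕ → Set
  Left  x i = x ≡ i × i < j
  Right x i = x ≡ 1 + j + i × i < j

  labels : List Labels
  labels = At j 0 1
         ∷ Progression Left (2 + j) (1 + 2 * j)
         ∷ Progression Right (2 * j + 2) (1 + 2 * j)
         ∷ At j 1 (1 + j + j * (1 + 2 * j))
         ∷ []

  m≤1+w : 2 * j + 1 ≤ suc (1 + 2 * j)
  m≤1+w = slack 1 (solve (j ∷ []))

  compatible : Compatible (⋃ labels) (⋃ labels)
  compatible = ⋃-compatible labels
    ( At-compatible
      , ( (compat λ { at (term {x} i (e , _)) →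
           leftward (linear (2 * i * j) (≤-reflexive e) (solve (j ∷ i ∷ x ∷ []))) })
        , (compat λ { at (term i _) → far (slack (1 + i + 2 * i * j) (solve (j ∷ i ∷ []))) })
        , (compat λ { at at → far (linear (1 + j) (scale (1 + 2 * j) 1≤j) (solve (j ∷ []))) })
        , tt)
    , Progression-compatible m≤1+w (λ (e , _) (e′ , _) → trans e (sym e′))
      , ( alternating m≤1+w (linear j (z≤n {0}) (solve (j ∷ []))) (slack (1 + j) (solve (j ∷ [])))
          (λ {i} {x} {x′} (e , _) (e′ , _) → rightward
            (linear 0 (≤-reflexive e ⊞ ≤-reflexive (sym e′)) (solve (j ∷ i ∷ x ∷ x′ ∷ []))))
          (λ {i} {x} {x′} (e , _) (e′ , _) → leftward
            (linear 0 (≤-reflexive (sym e) ⊞ ≤-reflexive e′) (solve (j ∷ i ∷ x ∷ x′ ∷ []))))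
        , (compat λ { (term i (_ , i<j)) at →
           far (linear 0 (scale (1 + 2 * j) i<j) (solve (j ∷ i ∷ []))) })
        , tt)
    , Progression-compatible m≤1+w (λ (e , _) (e′ , _) → trans e (sym e′))
      , ( (compat λ { (term {x} i (e , i<j)) at →
           leftward (linear 0 (scale (2 * j) i<j ⊞ ≤-reflexive (sym e)) (solve (j ∷ i ∷ x ∷ []))) })
        , tt)
    , At-compatible
      , tt
    , tt)

  covering : ∀ {x} → x < 2 * j + 1 → ∃ λ l → ⋃ labels x 0 l
  covering {x} x<m with <-cmp x j
  ... | tri≈ _ refl _ = _ , inj₁ at
  ... | tri< x<j _ _ = _ , inj₂ (inj₁ (term x (refl , x<j)))
  ... | tri> _ _ j<x with m≤n⇒∃[o]m+o≡n j<x
  ...   | i , refl = _ , inj₂ (inj₂ (inj₁ (term i (refl , linear 0 x<m (solve (i ∷ j ∷ []))))))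

  valid : Valid j (1 + j + j * (1 + 2 * j)) labels
  valid = record
    { compatible = compatible
    ; covering   = covering
    ; tip-label  = _ , inj₂ (inj₂ (inj₂ (inj₁ at)))
    ; bounded    = λ
      { (inj₁ at) →
          ≤-refl , slack (2 * j + 2 * j * j) (solve (j ∷ []))
      ; (inj₂ (inj₁ (term i (_ , i<j)))) →
          s≤s z≤n , linear (1 + j) (scale (1 + 2 * j) i<j ⊞ 1≤j) (solve (j ∷ i ∷ []))
      ; (inj₂ (inj₂ (inj₁ (term i (_ , i<j))))) →
          slack (1 + i + 2 * j + 2 * i * j) (solve (j ∷ i ∷ [])) ,
          linear 1 (scale (1 + 2 * j) i<j ⊞ 1≤j) (solve (j ∷ i ∷ []))
      ; (inj₂ (inj₂ (inj₂ (inj₁ at)))) →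
          s≤s z≤n , ≤-refl
      }
    }

-- n = 2k and s = k − 1 with k = 2 + t.  The visiting order is
-- v_{k−1}, v_{2k−1}, v_n, v_{2k−2}, v_{k−2}, v_{2k−3}, v_{k−3}, …, v_1, v_k,
-- with excess 1 between v_{2k−1} and v_n.
module SubcentralLabelling (t : ℕ) where

  open Labelling (2 * t + 3)

  Left Right : ℕ → ℕ → Set
  Left  x i = x + i + 1 ≡ t × i < t
  Right x i = x + i ≡ 1 + 2 * t × i ≤ t

  labels : List Labels
  labels = At t 0 1
         ∷ At (2 + 2 * t) 0 (2 + t)
         -- The tip is adjacent to the vertex labelled 1, so its label is at least `1 + (m - 1)`.
         -- This is what causes the excess.
         ∷ At t 1 (3 + 2 * t)
         ∷ Progression Right (4 + 3 * t) (3 + 2 * t)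
         ∷ Progression Left (5 + 4 * t) (3 + 2 * t)
         ∷ []

  m≤1+w : 2 * t + 3 ≤ suc (3 + 2 * t)
  m≤1+w = slack 1 (solve (t ∷ []))

  compatible : Compatible (⋃ labels) (⋃ labels)
  compatible = ⋃-compatible labels
    ( At-compatible
      , ( (compat λ { at at → rightward (slack 0 (solve (t ∷ []))) })
        , (compat λ { at at → far (slack 0 (solve (t ∷ []))) })
        , (compat λ { at (term i _) →
           far (slack (1 + 3 * i + t + 2 * i * t) (solve (t ∷ i ∷ []))) })
        , (compat λ { at (term i _) →
           far (slack (2 + 3 * i + 2 * t + 2 * i * t) (solve (t ∷ i ∷ []))) })
        , tt)
    , At-compatible
      , ( (compat λ { at at → leftward (slack 1 (solve (t ∷ []))) })
        , (compat λ { at (term i _) → far (slack (3 * i + 2 * i * t) (solve (t ∷ i ∷ []))) })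
        , (compat λ { at (term i _) →
           far (slack (1 + 3 * i + t + 2 * i * t) (solve (t ∷ i ∷ []))) })
        , tt)
    , At-compatible
      , ( (compat λ { at (term {x} i (e , _)) →
           rightward (linear (2 * i + 2 * i * t) (≤-reflexive (sym e)) (solve (t ∷ i ∷ x ∷ []))) })
        , (compat λ { at (term i _) → far (slack (3 * i + 2 * i * t) (solve (t ∷ i ∷ []))) })
        , tt)
    , Progression-compatible m≤1+w (λ {x} {x′} {i} (e , _) (e′ , _) →
        +-cancelʳ-≡ i x x′ (trans e (sym e′)))
      , ( alternating m≤1+w (slack (1 + t) (solve (t ∷ []))) (slack (2 + t) (solve (t ∷ [])))
          (λ {i} {x} {x′} (e , _) (e′ , _) → leftward
            (linear 0 (≤-reflexive (sym e) ⊞ ≤-reflexive e′) (solve (t ∷ i ∷ x ∷ x′ ∷ []))))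
          (λ {i} {x} {x′} (e , _) (e′ , _) → rightward
            (linear 0 (≤-reflexive e ⊞ ≤-reflexive (sym e′)) (solve (t ∷ i ∷ x ∷ x′ ∷ []))))
        , tt)
    , Progression-compatible m≤1+w (λ {x} {x′} {i} (e , _) (e′ , _) →
        +-cancelʳ-≡ i x x′ (+-cancelʳ-≡ 1 (x + i) (x′ + i) (trans e (sym e′))))
      , tt
    , tt)

  covering : ∀ {x} → x < 2 * t + 3 → ∃ λ l → ⋃ labels x 0 l
  covering {x} x<m with <-cmp x t
  ... | tri≈ _ refl _ = _ , inj₁ at
  ... | tri< x<t _ _ with m≤n⇒∃[o]m+o≡n x<t
  ...   | i , 1+x+i≡t = _ , inj₂ (inj₂ (inj₂ (inj₂ (inj₁ (term i
    ( trans (+-comm (x + i) 1) 1+x+i≡t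
    , linear x (≤-reflexive 1+x+i≡t) (solve (x ∷ i ∷ t ∷ []))))))))
  covering {x} x<m | tri> _ _ t<x
    with m≤n⇒m<n∨m≡n {x} {2 + 2 * t} (linear 0 x<m (solve (x ∷ t ∷ [])))
  ... | inj₂ refl = _ , inj₂ (inj₁ at)
  ... | inj₁ (s≤s x≤1+2t) with m≤n⇒∃[o]m+o≡n x≤1+2t
  ...   | i , x+i≡1+2t = _ , inj₂ (inj₂ (inj₂ (inj₁ (term i
    (x+i≡1+2t , linear 0 (t<x ⊞ ≤-reflexive x+i≡1+2t) (solve (x ∷ i ∷ t ∷ [])))))))

  valid : Valid t (4 + 3 * t + t * (3 + 2 * t)) labels
  valid = record
    { compatible = compatible
    ; covering   = covering
    ; tip-label  = _ , inj₂ (inj₂ (inj₁ at))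
    ; bounded    = λ
      { (inj₁ at) →
          ≤-refl , slack (3 + 6 * t + 2 * t * t) (solve (t ∷ []))
      ; (inj₂ (inj₁ at)) →
          s≤s z≤n , slack (2 + 5 * t + 2 * t * t) (solve (t ∷ []))
      ; (inj₂ (inj₂ (inj₁ at))) →
          s≤s z≤n , slack (1 + 4 * t + 2 * t * t) (solve (t ∷ []))
      ; (inj₂ (inj₂ (inj₂ (inj₁ (term i (_ , i≤t)))))) →
          s≤s z≤n , linear 0 (scale (3 + 2 * t) i≤t) (solve (t ∷ i ∷ []))
      ; (inj₂ (inj₂ (inj₂ (inj₂ (inj₁ (term i (_ , i<t))))))) →
          s≤s z≤n , linear (2 + t) (scale (3 + 2 * t) i<t) (solve (t ∷ i ∷ []))
      }
    }

-- n = 2k and s ≤ k − 2 with k = 3 + r.  The visiting order is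
-- v_{k−1}, v_{2k−1}, v_n, v_{k+1}, v_2, v_{k+2}, v_3, …, v_{k−2}, v_{2k−2}, v_1, v_k,
-- with excess 1 between v_{2k−1} and v_n and between v_{2k−2} and v_1.
module PeripheralLabelling (r t : ℕ) (1≤t : 1 ≤ t) (t≤r : t ≤ r) where

  open Labelling (2 * r + 5)

  Left Right : ℕ → ℕ → Set
  Left  x i = x ≡ 1 + i × i < r
  Right x i = x ≡ 3 + r + i × i ≤ r

  labels : List Labels
  labels = At (1 + r) 0 1
         ∷ At (4 + 2 * r) 0 (3 + r)
         -- The excess comes from the vertex two places earlier: `1 + r` has label 1 and lies at
         -- distance `r + 2 - t` from the tip, which makes this label the least possible.
         ∷ At t 1 (4 + r + t)
         ∷ Progression Right (5 + 2 * r + 2 * t) (5 + 2 * r)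
         ∷ Progression Left (8 + 3 * r + 2 * t) (5 + 2 * r)
         -- Here too the vertex two places earlier decides: it is `r`, the last one of `Left`, and
         -- its label is smaller by exactly `m - r`.
         ∷ At 0 0 (8 + 2 * r + 2 * t + r * (5 + 2 * r))
         ∷ At (2 + r) 0 (11 + 3 * r + 2 * t + r * (5 + 2 * r))
         ∷ []

  m≤1+w : 2 * r + 5 ≤ suc (5 + 2 * r)
  m≤1+w = slack 1 (solve (r ∷ []))

  1≤r : 1 ≤ r
  1≤r = ≤-trans 1≤t t≤r

  compatible : Compatible (⋃ labels) (⋃ labels)
  compatible = ⋃-compatible labels
    ( At-compatible
      , ( (compat λ { at at → rightward (slack 0 (solve (r ∷ []))) })
        , (compat λ { at at → leftward (slack 0 (solve (r ∷ t ∷ []))) })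
        , (compat λ { at (term i _) →
           far (slack (5 * i + 2 * t + 2 * i * r) (solve (r ∷ t ∷ i ∷ []))) })
        , (compat λ { at (term i _) →
           far (slack (3 + 5 * i + r + 2 * t + 2 * i * r) (solve (r ∷ t ∷ i ∷ []))) })
        , (compat λ { at at →
           far (linear (8 + 2 * r + 2 * t) (scale (5 + 2 * r) 1≤r) (solve (r ∷ t ∷ []))) })
        , (compat λ { at at →
           far (linear (11 + 3 * r + 2 * t) (scale (5 + 2 * r) 1≤r) (solve (r ∷ t ∷ []))) })
        , tt)
    , At-compatible
      , ( (compat λ { at at → leftward (slack 1 (solve (r ∷ t ∷ []))) })
        , (compat λ { at (term {x} i (e , _)) →
           leftward (linear (4 * i + 2 * i * r) (≤-reflexive e ⊞ 1≤t ⊞ 1≤t)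
             (solve (r ∷ t ∷ i ∷ x ∷ []))) })
        , (compat λ { at (term i _) →
           far (slack (1 + 5 * i + 2 * t + 2 * i * r) (solve (r ∷ t ∷ i ∷ []))) })
        , (compat λ { at at →
           far (linear (6 + r + 2 * t) (scale (5 + 2 * r) 1≤r) (solve (r ∷ t ∷ []))) })
        , (compat λ { at at →
           far (linear (9 + 2 * r + 2 * t) (scale (5 + 2 * r) 1≤r) (solve (r ∷ t ∷ []))) })
        , tt)
    , At-compatible
      , ( (compat λ { at (term {x} i (e , _)) →
           rightward (linear (6 * i + 2 * i * r) (≤-reflexive (sym e))
             (solve (r ∷ t ∷ i ∷ x ∷ []))) })
        , (compat λ { at (term i _) →
           far (linear (1 + 5 * i + 2 * i * r) 1≤t (solve (r ∷ t ∷ i ∷ []))) })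
        , (compat λ { at at →
           far (linear (5 + r + t) (scale (5 + 2 * r) 1≤r) (solve (r ∷ t ∷ []))) })
        , (compat λ { at at →
           far (linear (8 + 2 * r + t) (scale (5 + 2 * r) 1≤r) (solve (r ∷ t ∷ []))) })
        , tt)
    , Progression-compatible m≤1+w (λ (e , _) (e′ , _) → trans e (sym e′))
      , ( alternating m≤1+w (slack (3 + r) (solve (r ∷ t ∷ [])))
                          (slack (2 + r) (solve (r ∷ t ∷ [])))
          (λ {i} {x} {x′} (e , _) (e′ , _) → leftward
            (linear 0 (≤-reflexive (sym e) ⊞ ≤-reflexive e′) (solve (r ∷ t ∷ i ∷ x ∷ x′ ∷ []))))
          (λ {i} {x} {x′} (e , _) (e′ , _) → rightward
            (linear 0 (≤-reflexive e ⊞ ≤-reflexive (sym e′)) (solve (r ∷ t ∷ i ∷ x ∷ x′ ∷ []))))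
        , (compat λ { (term {x} i (e , i≤r)) at →
           leftward (linear 1 (scale (4 + 2 * r) i≤r ⊞ ≤-reflexive (sym e))
             (solve (r ∷ t ∷ i ∷ x ∷ []))) })
        , (compat λ { (term {x} i (e , i≤r)) at →
           leftward (linear 2 (scale (4 + 2 * r) i≤r ⊞ ≤-reflexive (sym e))
             (solve (r ∷ t ∷ i ∷ x ∷ []))) })
        , tt)
    , Progression-compatible m≤1+w (λ (e , _) (e′ , _) → trans e (sym e′))
      , ( (compat λ { (term {x} i (e , i<r)) at →
           leftward (linear 0 (scale (4 + 2 * r) i<r ⊞ ≤-reflexive (sym e))
             (solve (r ∷ t ∷ i ∷ x ∷ []))) })
        , (compat λ { (term i (_ , i<r)) at →
           far (linear 4 (scale (5 + 2 * r) i<r) (solve (r ∷ t ∷ i ∷ []))) })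
        , tt)
    , At-compatible
      , ( (compat λ { at at → rightward (slack 0 (solve (r ∷ t ∷ []))) })
        , tt)
    , At-compatible
      , tt
    , tt)

  covering : ∀ {x} → x < 2 * r + 5 → ∃ λ l → ⋃ labels x 0 l
  covering {zero} x<m = _ , inj₂ (inj₂ (inj₂ (inj₂ (inj₂ (inj₁ at)))))
  covering {suc x} x<m with <-cmp x r
  ... | tri≈ _ refl _ = _ , inj₁ at
  ... | tri< x<r _ _ = _ , inj₂ (inj₂ (inj₂ (inj₂ (inj₁ (term x (refl , x<r))))))
  ... | tri> _ _ r<x with m≤n⇒m<n∨m≡n r<x
                 | m≤n⇒m<n∨m≡n {x} {3 + 2 * r} (linear 0 x<m (solve (x ∷ r ∷ [])))
  ...   | inj₂ refl | _         = _ , inj₂ (inj₂ (inj₂ (inj₂ (inj₂ (inj₂ (inj₁ at))))))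
  ...   | inj₁ _    | inj₂ refl = _ , inj₂ (inj₁ at)
  ...   | inj₁ 1+r<x | inj₁ x<3+2r with m≤n⇒∃[o]m+o≡n 1+r<x
  ...     | i , refl = _ , inj₂ (inj₂ (inj₂ (inj₁ (term i
    (refl , linear 0 x<3+2r (solve (i ∷ r ∷ [])))))))

  valid : Valid t (11 + 3 * r + 2 * t + r * (5 + 2 * r)) labels
  valid = record
    { compatible = compatible
    ; covering   = covering
    ; tip-label  = _ , inj₂ (inj₂ (inj₁ at))
    ; bounded    = λ
      { (inj₁ at) →
          ≤-refl , slack (10 + 8 * r + 2 * t + 2 * r * r) (solve (r ∷ t ∷ []))
      ; (inj₂ (inj₁ at)) →
          s≤s z≤n , slack (8 + 7 * r + 2 * t + 2 * r * r) (solve (r ∷ t ∷ []))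
      ; (inj₂ (inj₂ (inj₁ at))) →
          s≤s z≤n , slack (7 + 7 * r + t + 2 * r * r) (solve (r ∷ t ∷ []))
      ; (inj₂ (inj₂ (inj₂ (inj₁ (term i (_ , i≤r)))))) →
          s≤s z≤n , linear (6 + r) (scale (5 + 2 * r) i≤r) (solve (r ∷ t ∷ i ∷ []))
      ; (inj₂ (inj₂ (inj₂ (inj₂ (inj₁ (term i (_ , i<r))))))) →
          s≤s z≤n , linear (8 + 2 * r) (scale (5 + 2 * r) i<r) (solve (r ∷ t ∷ i ∷ []))
      ; (inj₂ (inj₂ (inj₂ (inj₂ (inj₂ (inj₁ at)))))) →
          s≤s z≤n , slack (3 + r) (solve (r ∷ t ∷ []))
      ; (inj₂ (inj₂ (inj₂ (inj₂ (inj₂ (inj₂ (inj₁ at))))))) →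
          s≤s z≤n , ≤-refl
      }
    }

-- Lower bounds

telescope-step : ∀ {cx cy cz lx ly lz e E N K S} → cx + K + e ≤ cy + lx + ly →
                 cy + N + (ly + E + lz) ≤ cz + 2 * S →
                 cx + (K + N) + (lx + (e + E) + lz) ≤ cz + 2 * (lx + S)
telescope-step {cx} {cy} {cz} {lx} {ly} {lz} {e} {E} {N} {K} {S} p q =
  linear 0 (p ⊞ q) (identity cx cy cz lx ly lz e E N K S)
  where
  identity : ∀ cx cy cz lx ly lz e E N K S →
    cx + (K + N) + (lx + (e + E) + lz) + (cy + lx + ly + (cz + 2 * S)) + 0
    ≡ cz + 2 * (lx + S) + (cx + K + e + (cy + N + (ly + E + lz)))
  identity = solve-∀

-- A step from x to y needs c y − c x ≥ K − ℓ x − ℓ y; its excess is what it uses beyond that.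
module Itinerary {A : Set} (c ℓ : A → ℕ) (K : ℕ)
                 (c-step : ∀ {x y} → c x < c y → c x + K ≤ c y + ℓ x + ℓ y) where

  open import Data.List.Relation.Unary.All as All using (All; []; _∷_)
  open import Data.List.Relation.Unary.AllPairs using (AllPairs; []; _∷_)

  Ascending : List A → Set
  Ascending = AllPairs (λ x y → c x < c y)

  excess : A → A → ℕ
  excess x y = (c y + ℓ x + ℓ y) ∸ (c x + K)

  excess-spec : ∀ {x y} → c x < c y → c x + K + excess x y ≡ c y + ℓ x + ℓ y
  excess-spec x<y = m+[n∸m]≡n (c-step x<y)

  totalExcess : A → List A → ℕ
  totalExcess x []       = 0
  totalExcess x (y ∷ ys) = excess x y + totalExcess y ys

  last : A → List A → A
  last x []       = x
  last x (y ∷ ys) = last y ys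

  All-last : ∀ {P : A → Set} {x xs} → All P (x ∷ xs) → P (last x xs)
  All-last (px ∷ [])         = px
  All-last (px ∷ (py ∷ pys)) = All-last (py ∷ pys)

  -- An end of the order takes part in one step only, every other vertex in two. Against twice the
  -- sum of `ℓ`, the end values are therefore lost just like the excesses.
  cost : A → List A → ℕ
  cost x xs = ℓ x + totalExcess x xs + ℓ (last x xs)

  telescope : ∀ {x xs} → Ascending (x ∷ xs) →
              c x + length xs * K + cost x xs ≤ c (last x xs) + 2 * sum (map ℓ (x ∷ xs))
  telescope {x} {[]} _ = ≤-reflexive (identity (c x) (ℓ x))
    where
    identity : ∀ c l → c + 0 + (l + 0 + l) ≡ c + 2 * (l + 0)
    identity = solve-∀
  telescope {x} {y ∷ ys} ((x<y ∷ _) ∷ asc) = telescope-step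
    {cx = c x} {cy = c y} {cz = c (last y ys)} {e = excess x y} {K = K} {S = sum (map ℓ (y ∷ ys))}
    (≤-reflexive (excess-spec x<y)) (telescope asc)

  -- Orders that alternate between two sides.

  module Alternation
    (side : A → Bool) (same-side : ∀ {x y} → c x < c y → side x ≡ side y → 1 ≤ excess x y)
    (a : A) (around-a : ∀ {x z} → c x < c a → c a < c z → 1 ≤ excess x a + excess a z)
    where

    open import Data.List.Membership.Propositional using (_∈_)
    open import Data.List.Relation.Unary.Any using (here; there)
    open import Data.List.Relation.Unary.Linked using (Linked; []; [-]; _∷_)

    e+e≤totalExcess : ∀ {w e e′ E} → w ≤ e + e′ → w ≤ e + (e′ + E)
    e+e≤totalExcess {w} {e} {e′} {E} w≤ = subst (w ≤_) (+-assoc e e′ E) (m≤n⇒m≤n+o E w≤)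

    a∈⇒excess : ∀ {x xs} → Ascending (x ∷ xs) → a ∈ xs → 1 ≤ totalExcess x xs ⊎ last x xs ≡ a
    a∈⇒excess {xs = _ ∷ []}    _ (here refl) = inj₂ refl
    a∈⇒excess {x} {_ ∷ z ∷ zs} ((x<a ∷ _) ∷ (a<z ∷ _) ∷ _) (here refl) =
      inj₁ (e+e≤totalExcess {e = excess x a} (around-a x<a a<z))
    a∈⇒excess {x} {y ∷ ys} (_ ∷ asc) (there a∈ys) with a∈⇒excess asc a∈ys
    ... | inj₁ 1≤ = inj₁ (m≤n⇒m≤o+n (excess x y) 1≤)
    ... | inj₂ eq = inj₂ eq

    1≤cost : ∀ {x xs} → 1 ≤ ℓ a → Ascending (x ∷ xs) → a ∈ x ∷ xs → 1 ≤ cost x xs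
    1≤cost {x} {xs} 1≤ℓa asc (here refl) = m≤n⇒m≤n+o _ (m≤n⇒m≤n+o _ 1≤ℓa)
    1≤cost {x} {xs} 1≤ℓa asc (there a∈xs) with a∈⇒excess asc a∈xs
    ... | inj₁ 1≤   = m≤n⇒m≤n+o _ (m≤n⇒m≤o+n (ℓ x) 1≤)
    ... | inj₂ refl = m≤n⇒m≤o+n (ℓ x + totalExcess x xs) 1≤ℓa

    flips : ℕ → Bool → Bool
    flips zero    s = s
    flips (suc n) s = flips n (not s)

    flips-even : ∀ n s → flips (2 * n) s ≡ s
    flips-even zero    s = refl
    flips-even (suc n) s rewrite +-suc n (n + 0) | not-involutive s = flips-even n s

    Alternating : List A → Set
    Alternating = Linked (λ x y → side x ≢ side y)

    -- The cases are no, at least two, or exactly one same-side step, each such step costing 1. In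
    -- the last case the side of the final vertex is shifted, which is what later rules it out.
    alternation : ∀ {x xs} → Ascending (x ∷ xs) →
             Alternating (x ∷ xs) × side (last x xs) ≡ flips (length xs) (side x)
           ⊎ 2 ≤ totalExcess x xs
           ⊎ 1 ≤ totalExcess x xs × side (last x xs) ≡ flips (suc (length xs)) (side x)
    alternation {xs = []} _ = inj₁ ([-] , refl)
    alternation {x} {y ∷ ys} ((x<y ∷ _) ∷ asc) with side x ≟ᵇ side y | alternation asc
    ... | _ | inj₂ (inj₁ 2≤) = inj₂ (inj₁ (m≤n⇒m≤o+n (excess x y) 2≤))
    ... | yes x≡y | inj₁ (alt , eq) = inj₂ (inj₂ (m≤n⇒m≤n+o _ (same-side x<y x≡y) ,
      trans eq (cong (flips (length ys)) (trans (sym x≡y) (sym (not-involutive (side x)))))))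
    ... | yes x≡y | inj₂ (inj₂ (1≤ , eq)) = inj₂ (inj₁ (same-side x<y x≡y ⊞ 1≤))
    ... | no x≢y | inj₁ (alt , eq) = inj₁ (x≢y ∷ alt ,
      trans eq (cong (flips (length ys)) (¬-not (≢-sym x≢y))))
    ... | no x≢y | inj₂ (inj₂ (1≤ , eq)) = inj₂ (inj₂ (m≤n⇒m≤o+n (excess x y) 1≤ ,
      trans eq (cong (flips (suc (length ys))) (¬-not (≢-sym x≢y)))))

    left right : Bool
    left  = true
    right = false

    -- `h` is exempt because it lies on the centre: the distance from `h` to another left vertex `x`
    -- is all of `ℓ x`, so comparing labels across `p` yields less there.
    Costly : (h p : A) → ℕ → Set
    Costly h p w = ∀ {x z} → c x < c p → c p < c z → side x ≡ left → side z ≡ left →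
                   x ≢ h → z ≢ h → w ≤ excess x p + excess p z

    opposite-right : ∀ {x p} → side p ≡ right → side x ≢ side p → side x ≡ left
    opposite-right p≡right x≢p = ¬-not (λ x≡right → x≢p (trans x≡right (sym p≡right)))

    visit : ∀ {h p w x xs} → side p ≡ right → Costly h p w → Ascending (x ∷ xs) →
            Alternating (x ∷ xs) → All (_≢ h) (x ∷ xs) → p ∈ xs → last x xs ≢ p →
            w ≤ totalExcess x xs
    visit {xs = _ ∷ []} _ _ _ _ _ (here refl) last≢p = contradiction refl last≢p
    visit {x = x} {_ ∷ z ∷ zs} p≡right costly ((x<p ∷ _) ∷ (p<z ∷ _) ∷ _) (x≢p ∷ p≢z ∷ _)
          (x≢h ∷ _ ∷ z≢h ∷ _) (here refl) _ =
      e+e≤totalExcess {e = excess x _} (costly x<p p<z (opposite-right p≡right x≢p)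
        (opposite-right p≡right (≢-sym p≢z)) x≢h z≢h)
    visit {x = x} {y ∷ ys} p≡right costly (_ ∷ asc) (_ ∷ alt) (_ ∷ ≢h) (there p∈ys) last≢p =
      m≤n⇒m≤o+n (excess x y) (visit p≡right costly asc alt ≢h p∈ys last≢p)

    module _ (j : ℕ) (2≤ℓa : 2 ≤ ℓ a) (a≡right : side a ≡ right)
             {b h g : A} (1≤ℓb : 1 ≤ ℓ b) (b≡right : side b ≡ right) (a≢b : a ≢ b)
             (h≡left : side h ≡ left) (g≡right : side g ≡ right) (ℓh≡0 : ℓ h ≡ 0) (ℓg≡0 : ℓ g ≡ 0)
             (ℓ≡0⇒ : ∀ {x} → ℓ x ≡ 0 → x ≡ h ⊎ x ≡ g)
             (costly-a : Costly h a 2) (costly-b : Costly h b 1) where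

      ≢-last : ∀ {x xs p} → Ascending (x ∷ xs) → p ∈ xs → x ≢ last x xs
      ≢-last {xs = y ∷ ys} (x< ∷ _) _ eq = <-irrefl (cong c eq) (All-last x<)

      ∈-tail : ∀ {p q z zs} →
               side p ≡ right → side q ≡ right → side q ≢ side z → p ∈ z ∷ zs → p ∈ zs
      ∈-tail p≡right q≡right q≢z (here refl) = contradiction (trans q≡right (sym p≡right)) q≢z
      ∈-tail p≡right q≡right q≢z (there p∈)  = p∈

      last≢ : ∀ {x xs p} → ℓ (last x xs) ≡ 0 → 1 ≤ ℓ p → last x xs ≢ p
      last≢ ℓ≡0 1≤ℓp refl = contradiction (sym ℓ≡0) (<⇒≢ 1≤ℓp)

      1≤ℓa : 1 ≤ ℓ a
      1≤ℓa = <⇒≤ 2≤ℓa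

      -- Only the second vertex is next to `h`. If it is `a`, then `around-a` still gives 1 and `b`
      -- gives another 1; if not, `a` alone gives 2. The two contributions use different steps,
      -- since `a` and `b` lie on the same side and are not consecutive.
      starting-at-h : ∀ {xs} → Ascending (h ∷ xs) → Alternating (h ∷ xs) → ℓ (last h xs) ≡ 0 →
                      a ∈ xs → b ∈ xs → 2 ≤ totalExcess h xs
      starting-at-h {_ ∷ []} _ _ ℓ≡0 (here refl) _ =
        contradiction refl (last≢ {h} {a ∷ []} ℓ≡0 1≤ℓa)
      starting-at-h {_ ∷ z ∷ zs} ((h<a ∷ h<s) ∷ (a<z ∷ _) ∷ asc) (_ ∷ a≢z ∷ alt) ℓ≡0
                    (here refl) b∈ =
        subst (2 ≤_) (+-assoc (excess h a) _ _) (around-a h<a a<z ⊞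
          visit b≡right costly-b asc alt (All.map (λ h<x x≡h → <-irrefl (cong c (sym x≡h)) h<x) h<s)
            (∈-tail b≡right a≡right a≢z (b∈zs b∈)) (last≢ {z} {zs} ℓ≡0 1≤ℓb))
        where
        b∈zs : b ∈ a ∷ z ∷ zs → b ∈ z ∷ zs
        b∈zs (here b≡a) = contradiction (sym b≡a) a≢b
        b∈zs (there b∈) = b∈
      starting-at-h {y ∷ ys} (h< ∷ asc) (_ ∷ alt) ℓ≡0 (there a∈) b∈ = m≤n⇒m≤o+n (excess h y)
        (visit a≡right costly-a asc alt (All.map (λ h<x x≡h → <-irrefl (cong c (sym x≡h)) h<x) h<)
          a∈ (last≢ {y} {ys} ℓ≡0 1≤ℓa))

      -- Whichever of `a` and `b` comes first is not next to the final `h`, because the other one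
      -- still lies beyond its successor. If `a` is first it gives 2; if `b` is first it gives 1 and
      -- `a` adds 1 later.
      ending-at-h : ∀ {x xs} → Ascending (x ∷ xs) → Alternating (x ∷ xs) → last x xs ≡ h →
                    a ∈ xs → b ∈ xs → 2 ≤ totalExcess x xs
      ending-at-h _ _ _ (here refl) (here b≡a) = contradiction (sym b≡a) a≢b
      ending-at-h {x} {_ ∷ z ∷ zs} asc@((x<a ∷ _) ∷ (a<z ∷ _) ∷ asc′) (x≢a ∷ a≢z ∷ _) refl
                  (here refl) (there b∈) =
        e+e≤totalExcess {e = excess x a} (costly-a x<a a<z
          (opposite-right a≡right x≢a) (opposite-right a≡right (≢-sym a≢z))
          (≢-last asc (here refl)) (≢-last asc′ (∈-tail b≡right a≡right a≢z b∈)))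
      ending-at-h {x} {_ ∷ z ∷ zs} asc@((x<b ∷ _) ∷ (b<z ∷ _) ∷ asc′) (x≢b ∷ b≢z ∷ _) refl
                  (there a∈) (here refl)
        with ∈-tail a≡right b≡right b≢z a∈
      ... | a∈zs with a∈⇒excess asc′ a∈zs
      ...   | inj₂ last≡a = contradiction last≡a (last≢ {z} {zs} ℓh≡0 1≤ℓa)
      ...   | inj₁ 1≤ = subst (2 ≤_) (+-assoc (excess x b) _ _) (costly-b x<b b<z
          (opposite-right b≡right x≢b) (opposite-right b≡right (≢-sym b≢z))
          (≢-last asc (here refl)) (≢-last asc′ a∈zs) ⊞ 1≤)
      ending-at-h {x} {y ∷ ys} (_ ∷ asc) (_ ∷ alt) last≡h (there a∈) (there b∈) =
        m≤n⇒m≤o+n (excess x y) (ending-at-h asc alt last≡h a∈ b∈)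

      2≤cost : ∀ {x xs} → Ascending (x ∷ xs) → length xs ≡ 1 + 2 * j →
               (∀ v → v ∈ x ∷ xs) → 2 ≤ cost x xs
      2≤cost {x} {xs} asc len all∈ with ℓ x + ℓ (last x xs) ≟ 0 | all∈ a | all∈ b
      ... | no ≢0 | here refl | _ = m≤n⇒m≤n+o _ (m≤n⇒m≤n+o _ 2≤ℓa)
      ... | no ≢0 | there a∈xs | _ with a∈⇒excess asc a∈xs
      ...   | inj₁ 1≤   = subst (2 ≤_) (reorder (ℓ x) _ (ℓ (last x xs))) (n≢0⇒n>0 ≢0 ⊞ 1≤)
        where
        reorder : ∀ p q r → p + r + q ≡ p + q + r
        reorder = solve-∀
      ...   | inj₂ refl = m≤n⇒m≤o+n (ℓ x + totalExcess x xs) 2≤ℓa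
      2≤cost {x} {xs} asc len all∈ | yes ≡0 | here refl | _ =
        contradiction (sym (m+n≡0⇒m≡0 (ℓ a) ≡0)) (<⇒≢ 1≤ℓa)
      2≤cost {x} {xs} asc len all∈ | yes ≡0 | there _ | here refl =
        contradiction (sym (m+n≡0⇒m≡0 (ℓ b) ≡0)) (<⇒≢ 1≤ℓb)
      2≤cost {x} {xs} asc len all∈ | yes ≡0 | there a∈ | there b∈ =
        m≤n⇒m≤n+o _ (m≤n⇒m≤o+n (ℓ x) 2≤totalExcess)
        where
        end≡0 : ℓ (last x xs) ≡ 0
        end≡0 = m+n≡0⇒n≡0 (ℓ x) ≡0

        -- The number of vertices is even, so a single same-side step leaves an even number of side
        -- changes. The order would start and end on the same side, but `h` and `g` lie on opposite
        -- ones.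
        closed : side (last x xs) ≡ flips (suc (length xs)) (side x) → side (last x xs) ≡ side x
        closed eq rewrite len | not-involutive (side x) = trans eq (flips-even j (side x))

        2≤totalExcess : 2 ≤ totalExcess x xs
        2≤totalExcess with alternation asc | ℓ≡0⇒ (m+n≡0⇒m≡0 (ℓ x) ≡0) | ℓ≡0⇒ end≡0
        ... | inj₂ (inj₁ 2≤) | _ | _ = 2≤
        ... | _ | inj₁ x≡h | inj₁ end≡h = contradiction (trans x≡h (sym end≡h)) (≢-last asc a∈)
        ... | _ | inj₂ x≡g | inj₂ end≡g = contradiction (trans x≡g (sym end≡g)) (≢-last asc a∈)
        ... | inj₁ (alt , _) | inj₁ refl | inj₂ _ = starting-at-h asc alt end≡0 a∈ b∈
        ... | inj₁ (alt , _) | inj₂ _ | inj₁ end≡h = ending-at-h asc alt end≡h a∈ b∈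
        ... | inj₂ (inj₂ (_ , eq)) | inj₁ refl | inj₂ end≡g = contradiction
          (trans (sym h≡left) (trans (sym (closed eq)) (trans (cong side end≡g) g≡right))) λ ()
        ... | inj₂ (inj₂ (_ , eq)) | inj₂ refl | inj₁ end≡h = contradiction
          (trans (sym h≡left) (trans (cong side (sym end≡h)) (trans (closed eq) g≡right))) λ ()

-- Sums of distances along the spine.

Σ< : ℕ → (ℕ → ℕ) → ℕ
Σ< zero    f = 0
Σ< (suc n) f = f 0 + Σ< n (f ∘ suc)

sum-allFin : ∀ n (f : ℕ → ℕ) → sum (map (f ∘ toℕ) (allFin n)) ≡ Σ< n f
sum-allFin n f = trans (cong sum (map-tabulate {n = n} id (f ∘ toℕ))) (sum-tabulate n f)
  where
  sum-tabulate : ∀ n (f : ℕ → ℕ) → sum (tabulate {n = n} (f ∘ toℕ)) ≡ Σ< n f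
  sum-tabulate zero    f = refl
  sum-tabulate (suc n) f = cong (f 0 +_) (sum-tabulate n (f ∘ suc))

Σ<-cong : ∀ n {f g : ℕ → ℕ} → (∀ {i} → i < n → f i ≡ g i) → Σ< n f ≡ Σ< n g
Σ<-cong zero    f≡g = refl
Σ<-cong (suc n) f≡g = cong₂ _+_ (f≡g (s≤s z≤n)) (Σ<-cong n (f≡g ∘ s≤s))

Σ<-split : ∀ m n {f : ℕ → ℕ} → Σ< (m + n) f ≡ Σ< m f + Σ< n (λ i → f (m + i))
Σ<-split zero    n     = refl
Σ<-split (suc m) n {f} = trans (cong (f 0 +_) (Σ<-split m n)) (sym (+-assoc (f 0) _ _))

Σ<-snoc : ∀ n {f : ℕ → ℕ} → Σ< (suc n) f ≡ Σ< n f + f n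
Σ<-snoc zero    {f} = +-identityʳ (f 0)
Σ<-snoc (suc n) {f} = trans (cong (f 0 +_) (Σ<-snoc n)) (sym (+-assoc (f 0) _ _))

Σ<-id : ∀ n → 2 * Σ< n id + n ≡ n * n
Σ<-id zero    = refl
Σ<-id (suc n) rewrite Σ<-snoc n {id} =
  trans (regroup (Σ< n id) n) (trans (cong (_+ (n + n + 1)) (Σ<-id n)) (square n))
  where
  regroup : ∀ s n → 2 * (s + n) + (1 + n) ≡ 2 * s + n + (n + n + 1)
  regroup = solve-∀
  square : ∀ n → n * n + (n + n + 1) ≡ (1 + n) * (1 + n)
  square = solve-∀

Σ<-∣i-n∣ : ∀ n → 2 * Σ< n (λ i → ∣ i - n ∣) ≡ n * n + n
Σ<-∣i-n∣ zero    = refl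
Σ<-∣i-n∣ (suc n) =
  trans (*-distribˡ-+ 2 (suc n) _) (trans (cong (2 * suc n +_) (Σ<-∣i-n∣ n)) (square n))
  where
  square : ∀ n → 2 * (1 + n) + (n * n + n) ≡ (1 + n) * (1 + n) + (1 + n)
  square = solve-∀

Σ<-∣j+i-j∣ : ∀ j n → Σ< n (λ i → ∣ j + i - j ∣) ≡ Σ< n id
Σ<-∣j+i-j∣ j n = Σ<-cong n λ {i} _ → ∣m+n-m∣≡n j i

-- Adding the equations of two consecutive steps eliminates the label of the middle vertex `p`; the
-- result is compared with the direct condition on `x` and `z`. Here `K + 1` plays the role of `m`,
-- `d` is the distance from `x` to `z`, and `w` is how far it falls short of `ℓx + ℓz`.
excess-pair : ∀ {cx cp cz ℓx ℓp ℓz K e e′ d w} →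
              cx + K + e ≡ cp + ℓx + ℓp → cp + K + e′ ≡ cz + ℓp + ℓz →
              cx + (K + 1) ≤ cz + d → d + w ≤ ℓx + ℓz → 1 + w + 2 * ℓp ≤ K + (e + e′)
excess-pair {cx} {cp} {cz} {ℓx} {ℓp} {ℓz} {K} {e} {e′} {d} {w} xp pz xz d+w≤ =
  linear 0 (≤-reflexive (sym xp) ⊞ ≤-reflexive (sym pz) ⊞ xz ⊞ d+w≤)
    (identity cx cp cz ℓx ℓp ℓz K e e′ d w)
  where
  identity : ∀ cx cp cz ℓx ℓp ℓz K e e′ d w →
    1 + w + 2 * ℓp + (cx + K + e + (cp + K + e′) + (cz + d) + (ℓx + ℓz)) + 0
    ≡ K + (e + e′) + (cp + ℓx + ℓp + (cz + ℓp + ℓz) + (cx + (K + 1)) + (d + w))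
  identity = solve-∀

-- The span of an arbitrary radio labelling.

module LowerBound (m t : ℕ) (1≤t : 1 ≤ t) (t+2≤m : t + 2 ≤ m)
                  (c : Fin (suc m) → ℕ) (radio : IsRadioLabeling (spire (suc m) (suc t)) c) where

  open Spire m t 1≤t t+2≤m

  c-separated : ∀ {u v} → u ≢ v → m ≤ δ u v + ∣ c u - c v ∣
  c-separated {u} {v} u≢v =
    subst₂ (λ d e → d ≤ e + ∣ c u - c v ∣) diam+1≡m (dist≡δ u v) (proj₂ radio u v u≢v)

  c-gap : ∀ {u v} → c u < c v → c u + m ≤ c v + δ u v
  c-gap {u} {v} u<v = begin
    c u + m                          ≤⟨ +-monoʳ-≤ (c u) (c-separated u≢v) ⟩
    c u + (δ u v + ∣ c u - c v ∣)    ≡⟨ regroup (c u) (δ u v) ∣ c u - c v ∣ ⟩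
    c u + ∣ c u - c v ∣ + δ u v      ≡⟨ cong (λ d → c u + d + δ u v) (m≤n⇒∣m-n∣≡n∸m (<⇒≤ u<v)) ⟩
    c u + (c v ∸ c u) + δ u v        ≡⟨ cong (_+ δ u v) (m+[n∸m]≡n (<⇒≤ u<v)) ⟩
    c v + δ u v                      ∎
    where
    open ≤-Reasoning
    u≢v : u ≢ v
    u≢v refl = <-irrefl refl u<v
    regroup : ∀ a d e → a + (d + e) ≡ a + e + d
    regroup = solve-∀

  c-injective : ∀ {u v} → u ≢ v → c u ≢ c v
  c-injective {u} {v} u≢v cu≡cv = <⇒≱ (δ<m u v) (subst (m ≤_) δ+0 (c-separated u≢v))
    where
    δ+0 : δ u v + ∣ c u - c v ∣ ≡ δ u v
    δ+0 = trans (cong (δ u v +_) (m≡n⇒∣m-n∣≡0 cu≡cv)) (+-identityʳ (δ u v))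

  byLabel : DecTotalOrder _ _ _
  byLabel = On.decTotalOrder ≤-decTotalOrder c

  open Sort byLabel using (sort; sort-↭; sort-↗)

  sort-strict : ∀ {us} → sort (allFin (suc m)) ≡ us → AllPairs.AllPairs (λ u v → c u < c v) us
  sort-strict refl = AllPairs.zipWith (λ { (u≤v , u≢v) → ≤∧≢⇒< u≤v (c-injective u≢v) })
    ( Sorted⇒AllPairs (DecTotalOrder.totalOrder byLabel) (sort-↗ (allFin (suc m)))
    , Permutation.Unique-resp-↭ (setoid V) (↭⇒↭ₛ (↭-sym (sort-↭ _))) (allFin⁺ (suc m)))

  module _ (ℓ : V → ℕ) (K : ℕ) (c-step : ∀ {u v} → c u < c v → c u + K ≤ c v + ℓ u + ℓ v) where

    open Itinerary c ℓ K c-step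

    -- The leading 1 is the least admissible label. `w` stays open because the bounds differ in the
    -- cost that can be proved for the order.
    span-bound : ∀ w →
      (∀ {x xs} → Ascending (x ∷ xs) → length xs ≡ m → (∀ v → v ∈ x ∷ xs) → w ≤ cost x xs) →
      1 + m * K + w ≤ span c + 2 * sum (map ℓ (allFin (suc m)))
    span-bound w w≤cost with sort (allFin (suc m)) in eq
    ... | []     = contradiction length≡ λ ()
      where
      length≡ : suc m ≡ 0
      length≡ = trans (sym (length-tabulate {n = suc m} id))
        (trans (sym (↭-length (sort-↭ (allFin (suc m))))) (cong length eq))
    ... | x ∷ xs = begin
      1 + m * K + w
        ≤⟨ proj₁ radio x ⊞ ≤-reflexive (cong (_* K) (sym len)) ⊞ w≤cost (sort-strict eq) len all∈ ⟩
      c x + length xs * K + cost x xs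
        ≤⟨ telescope (sort-strict eq) ⟩
      c (last x xs) + 2 * sum (map ℓ (x ∷ xs))
        ≤⟨ ≤maxOver c (last x xs) ⊞ ≤-reflexive (cong (2 *_) (sum-↭ (map⁺ ℓ perm))) ⟩
      span c + 2 * sum (map ℓ (allFin (suc m)))
        ∎
      where
      open ≤-Reasoning
      perm : x ∷ xs ↭ allFin (suc m)
      perm = subst (_↭ allFin (suc m)) eq (sort-↭ _)
      len : length xs ≡ m
      len = suc-injective (trans (↭-length perm) (length-tabulate {n = suc m} id))
      all∈ : ∀ v → v ∈ x ∷ xs
      all∈ v = ∈-resp-↭ (↭-sym perm) (∈-allFin v)

  sum-ℓ : (f : ℕ → ℕ → ℕ) → sum (map (λ u → f (X u) (H u)) (allFin (suc m)))
                            ≡ Σ< m (λ x → f x 0) + f t 1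
  sum-ℓ f = trans (sum-allFin (suc m) (λ i → f (xcoord i) (hcoord i))) (trans
    (Σ<-snoc m {λ i → f (xcoord i) (hcoord i)}) (cong₂ _+_
      (Σ<-cong m λ i<m → cong₂ f (xcoord-spine (<⇒≢ i<m)) (hcoord-spine (<⇒≢ i<m)))
      (cong₂ f (xcoord-tip refl) (hcoord-tip refl))))

  -- Distances measured from a vertex.

  module VertexCentred (j b : ℕ) (m≡j+b : m ≡ j + b) (t≤j : t ≤ j) where

    ℓ : V → ℕ
    ℓ u = ∣ X u - j ∣ + H u

    δ≤ℓ+ℓ : ∀ u v → δ u v ≤ ℓ u + ℓ v
    δ≤ℓ+ℓ u v = ℓ¹-triangle (X u) (X v) j (H u) (H v)

    c-step : ∀ {u v} → c u < c v → c u + m ≤ c v + ℓ u + ℓ v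
    c-step {u} {v} u<v = ≤-trans (c-gap u<v)
      (subst (c v + δ u v ≤_) (sym (+-assoc (c v) (ℓ u) (ℓ v))) (+-monoʳ-≤ (c v) (δ≤ℓ+ℓ u v)))

    open Itinerary c ℓ m c-step

    ℓ≡0⇒ : ∀ u → ℓ u ≡ 0 → X u ≡ j × H u ≡ 0
    ℓ≡0⇒ u ℓ≡0 = ∣m-n∣≡0⇒m≡n (m+n≡0⇒m≡0 _ ℓ≡0) , m+n≡0⇒n≡0 ∣ X u - j ∣ ℓ≡0

    -- Only the centre has `ℓ` equal to 0, and the order has two different ends.
    1≤cost : ∀ {x xs} → Ascending (x ∷ xs) → length xs ≡ m → 1 ≤ cost x xs
    1≤cost {x} {[]} _ 0≡m = contradiction 0≡m (<⇒≢ 0<m)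
    1≤cost {x} {y ∷ ys} (x< AllPairs.∷ _) _ = n≢0⇒n>0 λ cost≡0 →
      let x≡ , hx = ℓ≡0⇒ x (m+n≡0⇒m≡0 (ℓ x) (m+n≡0⇒m≡0 _ cost≡0))
          z≡ , hz = ℓ≡0⇒ (last y ys) (m+n≡0⇒n≡0 (ℓ x + totalExcess x (y ∷ ys)) cost≡0)
      in <⇒≢ (All-last x<) (cong c (XH-injective (trans x≡ (sym z≡)) (trans hx (sym hz))))

    2∑ℓ : 2 * sum (map ℓ (allFin (suc m))) + b + 2 * t ≡ j * j + j + b * b + 2 * (j + 1)
    2∑ℓ = begin
      2 * sum (map ℓ (allFin (suc m))) + b + 2 * t
        ≡⟨ cong (λ s → 2 * s + b + 2 * t) (sum-ℓ (λ x h → ∣ x - j ∣ + h)) ⟩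
      2 * (Σ< m (λ x → ∣ x - j ∣ + 0) + (∣ t - j ∣ + 1)) + b + 2 * t
        ≡⟨ cong (λ s → 2 * (s + (∣ t - j ∣ + 1)) + b + 2 * t) spine-sum ⟩
      2 * (Σ< j (λ x → ∣ x - j ∣) + Σ< b id + (∣ t - j ∣ + 1)) + b + 2 * t
        ≡⟨ regroup (Σ< j (λ x → ∣ x - j ∣)) (Σ< b id) ∣ t - j ∣ b t ⟩
      2 * Σ< j (λ x → ∣ x - j ∣) + (2 * Σ< b id + b) + 2 * (∣ t - j ∣ + t + 1)
        ≡⟨ cong₂ _+_ (cong₂ _+_ (Σ<-∣i-n∣ j) (Σ<-id b))
             (cong (λ s → 2 * (s + 1)) (m≤n⇒∣m-n∣+m≡n t≤j)) ⟩
      j * j + j + b * b + 2 * (j + 1)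
        ∎
      where
      open ≡-Reasoning
      regroup : ∀ s s′ d b t → 2 * (s + s′ + (d + 1)) + b + 2 * t
                               ≡ 2 * s + (2 * s′ + b) + 2 * (d + t + 1)
      regroup = solve-∀
      spine-sum : Σ< m (λ x → ∣ x - j ∣ + 0) ≡ Σ< j (λ x → ∣ x - j ∣) + Σ< b id
      spine-sum = trans (Σ<-cong m λ _ → +-identityʳ _)
        (trans (cong (λ n → Σ< n (λ x → ∣ x - j ∣)) m≡j+b)
        (trans (Σ<-split j b) (cong (Σ< j (λ x → ∣ x - j ∣) +_) (Σ<-∣j+i-j∣ j b))))

    bound : 1 + m * m + 1 + (b + 2 * t) ≤ span c + (j * j + j + b * b + 2 * (j + 1))
    bound = begin
      1 + m * m + 1 + (b + 2 * t)
        ≤⟨ +-monoˡ-≤ (b + 2 * t) (span-bound ℓ m c-step 1 λ asc len _ → 1≤cost asc len) ⟩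
      span c + 2 * sum (map ℓ (allFin (suc m))) + (b + 2 * t)
        ≡⟨ regroup (span c) (2 * sum (map ℓ (allFin (suc m)))) b (2 * t) ⟩
      span c + (2 * sum (map ℓ (allFin (suc m))) + b + 2 * t)
        ≡⟨ cong (span c +_) 2∑ℓ ⟩
      span c + (j * j + j + b * b + 2 * (j + 1)) ∎
      where
      open ≤-Reasoning
      regroup : ∀ a s b t → a + s + (b + t) ≡ a + (s + b + t)
      regroup = solve-∀

  -- Distances measured from the central edge.

  module EdgeCentred (q : ℕ) (m≡2q+3 : m ≡ 2 * q + 3) (t≤q : t ≤ q) where

    -- Contracts the central edge, with ends q and 1 + q, to the point 1 + q.
    contract : ℕ → ℕ
    contract x = if does (x <? suc q) then suc x else x

    contract-left : ∀ {x} → x < suc q → contract x ≡ suc x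
    contract-left {x} x<1+q rewrite dec-true (x <? suc q) x<1+q = refl

    contract-right : ∀ {x} → ¬ x < suc q → contract x ≡ x
    contract-right {x} x≮1+q rewrite dec-false (x <? suc q) x≮1+q = refl

    Y : V → ℕ
    Y u = contract (X u)

    ℓ : V → ℕ
    ℓ u = ∣ Y u - suc q ∣ + H u

    side : V → Bool
    side u = does (X u <? suc q)

    data Half (u : V) : Set where
      onLeft  : X u ≤ q → side u ≡ true → Y u ≡ suc (X u) → Half u
      onRight : q < X u → side u ≡ false → Y u ≡ X u → Half u

    half : ∀ u → Half u
    half u with X u <? suc q
    ... | yes X<1+q = onLeft (s≤s⁻¹ X<1+q) (dec-true (X u <? suc q) X<1+q) (contract-left X<1+q)
    ... | no  X≮1+q = onRight (≮⇒≥ X≮1+q) (dec-false (X u <? suc q) X≮1+q) (contract-right X≮1+q)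

    ∣X-X∣-same : ∀ u v → side u ≡ side v → ∣ X u - X v ∣ ≡ ∣ Y u - Y v ∣
    ∣X-X∣-same u v eq with half u | half v
    ... | onLeft _ _ Yu  | onLeft _ _ Yv  rewrite Yu | Yv = refl
    ... | onRight _ _ Yu | onRight _ _ Yv rewrite Yu | Yv = refl
    ... | onLeft _ su _  | onRight _ sv _ = contradiction (trans (sym su) (trans eq sv)) λ ()
    ... | onRight _ su _ | onLeft _ sv _  = contradiction (trans (sym su) (trans eq sv)) λ ()

    ∣X-X∣≤ : ∀ u v → ∣ X u - X v ∣ ≤ ∣ Y u - Y v ∣ + 1
    ∣X-X∣≤ u v with half u | half v
    ... | onLeft _ _ Yu  | onLeft _ _ Yv  rewrite Yu | Yv = m≤m+n _ 1
    ... | onRight _ _ Yu | onRight _ _ Yv rewrite Yu | Yv = m≤m+n _ 1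
    ... | onLeft Xu≤q _ Yu | onRight q<Xv _ Yv rewrite Yu | Yv =
      ≤-reflexive (trans (m<n⇒∣m-n∣≡1+∣1+m-n∣ (≤-<-trans Xu≤q q<Xv)) (+-comm 1 _))
    ... | onRight q<Xu _ Yu | onLeft Xv≤q _ Yv
      rewrite Yu | Yv | ∣-∣-comm (X u) (X v) | ∣-∣-comm (X u) (suc (X v)) =
      ≤-reflexive (trans (m<n⇒∣m-n∣≡1+∣1+m-n∣ (≤-<-trans Xv≤q q<Xu)) (+-comm 1 _))

    ∣Y-Y∣+∣H-H∣≤ : ∀ u v → ∣ Y u - Y v ∣ + ∣ H u - H v ∣ ≤ ℓ u + ℓ v
    ∣Y-Y∣+∣H-H∣≤ u v = ℓ¹-triangle (Y u) (Y v) (suc q) (H u) (H v)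

    δ≤ℓ+ℓ+1 : ∀ u v → δ u v ≤ ℓ u + ℓ v + 1
    δ≤ℓ+ℓ+1 u v = linear 0 (∣X-X∣≤ u v ⊞ ∣Y-Y∣+∣H-H∣≤ u v)
      (regroup ∣ X u - X v ∣ ∣ Y u - Y v ∣ ∣ H u - H v ∣ (ℓ u) (ℓ v))
      where
      regroup : ∀ d y e p q → d + e + (y + 1 + (p + q)) + 0 ≡ p + q + 1 + (d + (y + e))
      regroup = solve-∀

    δ≤ℓ+ℓ : ∀ u v → side u ≡ side v → δ u v ≤ ℓ u + ℓ v
    δ≤ℓ+ℓ u v eq = subst (λ d → d + ∣ H u - H v ∣ ≤ ℓ u + ℓ v) (sym (∣X-X∣-same u v eq))
      (∣Y-Y∣+∣H-H∣≤ u v)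

    -- This is `m - 1`: the unit for crossing the central edge is granted to every step in advance.
    K : ℕ
    K = 2 * q + 2

    c-gap′ : ∀ {u v} → c u < c v → c u + (K + 1) ≤ c v + δ u v
    c-gap′ {u} {v} u<v = subst (λ m → c u + m ≤ c v + δ u v)
      (trans m≡2q+3 (sym (+-assoc (2 * q) 2 1))) (c-gap u<v)

    gap-arith : ∀ {cu cv d ℓu ℓv} o → cu + (K + 1) ≤ cv + d → d + o ≤ ℓu + ℓv + 1 →
                cu + K + o ≤ cv + ℓu + ℓv
    gap-arith {cu} {cv} {d} {ℓu} {ℓv} o p r = linear 0 (p ⊞ r) (regroup cu cv d ℓu ℓv o K)
      where
      regroup : ∀ cu cv d ℓu ℓv o K → cu + K + o + (cv + d + (ℓu + ℓv + 1)) + 0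
                                       ≡ cv + ℓu + ℓv + (cu + (K + 1) + (d + o))
      regroup = solve-∀

    c-step : ∀ {u v} → c u < c v → c u + K ≤ c v + ℓ u + ℓ v
    c-step {u} {v} u<v = subst (_≤ c v + ℓ u + ℓ v) (+-identityʳ _)
      (gap-arith {c u} {c v} {δ u v} {ℓ u} {ℓ v} 0 (c-gap′ u<v)
        (subst (_≤ ℓ u + ℓ v + 1) (sym (+-identityʳ _)) (δ≤ℓ+ℓ+1 u v)))

    open Itinerary c ℓ K c-step

    -- A step that does not cross the central edge wastes the unit granted in `K`.
    same-side : ∀ {u v} → c u < c v → side u ≡ side v → 1 ≤ excess u v
    same-side {u} {v} u<v eq = m<n⇒0<n∸m (subst (_≤ c v + ℓ u + ℓ v) (+-comm (c u + K) 1)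
      (gap-arith {c u} {c v} {δ u v} {ℓ u} {ℓ v} 1 (c-gap′ u<v) (+-monoˡ-≤ 1 (δ≤ℓ+ℓ u v eq))))

    around : ∀ {x p z} w → c x < c p → c p < c z → δ x z + w ≤ ℓ x + ℓ z →
             1 + w + 2 * ℓ p ≤ K + (excess x p + excess p z)
    around {x} {p} {z} w x<p p<z = excess-pair {c x} {c p} {c z} {ℓ x} {ℓ p} {ℓ z} {K} {excess x p}
      (excess-spec x<p) (excess-spec p<z) (c-gap′ (<-trans x<p p<z))

    2∑ℓ : 2 * sum (map ℓ (allFin (suc m))) + 2 * t ≡ 2 * (q * q) + 6 * q + 4
    2∑ℓ = begin
      2 * sum (map ℓ (allFin (suc m))) + 2 * t
        ≡⟨ cong (λ s → 2 * s + 2 * t) (sum-ℓ (λ x h → ∣ contract x - suc q ∣ + h)) ⟩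
      2 * (Σ< m (λ x → ∣ contract x - suc q ∣ + 0) + (∣ contract t - suc q ∣ + 1)) + 2 * t
        ≡⟨ cong₂ (λ s d → 2 * (s + (d + 1)) + 2 * t) spine-sum
             (cong (λ x → ∣ x - suc q ∣) (contract-left (s≤s t≤q))) ⟩
      2 * (Σ< q (λ x → ∣ x - q ∣) + Σ< (q + 2) id + (∣ t - q ∣ + 1)) + 2 * t
        ≡⟨ regroup (Σ< q (λ x → ∣ x - q ∣)) (Σ< (q + 2) id) ∣ t - q ∣ t ⟩
      2 * Σ< q (λ x → ∣ x - q ∣) + 2 * Σ< (q + 2) id + 2 * (∣ t - q ∣ + t + 1)
        ≡⟨ cong₂ _+_ (cong₂ _+_ (Σ<-∣i-n∣ q) up-sum)
             (cong (λ s → 2 * (s + 1)) (m≤n⇒∣m-n∣+m≡n t≤q)) ⟩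
      q * q + q + (q * q + 3 * q + 2) + 2 * (q + 1)
        ≡⟨ collect q ⟩
      2 * (q * q) + 6 * q + 4
        ∎
      where
      open ≡-Reasoning
      regroup : ∀ s s′ d t → 2 * (s + s′ + (d + 1)) + 2 * t ≡ 2 * s + 2 * s′ + 2 * (d + t + 1)
      regroup = solve-∀
      square : ∀ q → (q + 2) * (q + 2) ≡ q * q + 3 * q + 2 + (q + 2)
      square = solve-∀
      collect : ∀ q → q * q + q + (q * q + 3 * q + 2) + 2 * (q + 1) ≡ 2 * (q * q) + 6 * q + 4
      collect = solve-∀
      width : ∀ q → 2 * q + 3 ≡ (1 + q) + (q + 2)
      width = solve-∀
      left-sum : Σ< (suc q) (λ x → ∣ contract x - suc q ∣) ≡ Σ< q (λ x → ∣ x - q ∣)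
      left-sum = trans (Σ<-cong (suc q) λ x<1+q → cong (λ x → ∣ x - suc q ∣) (contract-left x<1+q))
        (trans (Σ<-snoc q) (trans (cong (Σ< q (λ x → ∣ x - q ∣) +_) (∣n-n∣≡0 q)) (+-identityʳ _)))
      up-sum : 2 * Σ< (q + 2) id ≡ q * q + 3 * q + 2
      up-sum = +-cancelʳ-≡ (q + 2) _ (q * q + 3 * q + 2) (trans (Σ<-id (q + 2)) (square q))
      right-sum : Σ< (q + 2) (λ i → ∣ contract (suc q + i) - suc q ∣) ≡ Σ< (q + 2) id
      right-sum = trans
        (Σ<-cong (q + 2) λ {i} _ → cong (λ x → ∣ x - suc q ∣) (contract-right (m+n≮m (suc q) i)))
        (Σ<-∣j+i-j∣ (suc q) (q + 2))
      spine-sum : Σ< m (λ x → ∣ contract x - suc q ∣ + 0) ≡ Σ< q (λ x → ∣ x - q ∣) + Σ< (q + 2) id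
      spine-sum = trans (Σ<-cong m λ _ → +-identityʳ _)
        (trans (cong (λ n → Σ< n (λ x → ∣ contract x - suc q ∣)) (trans m≡2q+3 (width q)))
        (trans (Σ<-split (suc q) (q + 2) {λ x → ∣ contract x - suc q ∣})
          (cong₂ _+_ left-sum right-sum)))

    -- abstract, so that the coordinates of a, b, g and h do not unfold.
    abstract
      onSpine : ∀ x → x ≤ 2 * q + 2 → Σ V λ u → X u ≡ x × H u ≡ 0
      onSpine x x≤ = let u , _ , XHu = vertex x<m in u , XHu
        where
        x<m : x < m
        x<m = subst (x <_) (sym m≡2q+3) (linear 0 x≤ (solve (x ∷ q ∷ [])))

    -- With k = 2 + q these are v_{n−1}, v_{n−2}, v_{k−1} and v_k.
    a b h g : V
    a = proj₁ (onSpine (2 * q + 2) ≤-refl)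
    b = proj₁ (onSpine (2 * q + 1) (slack 1 (solve (q ∷ []))))
    h = proj₁ (onSpine q (slack (q + 2) (solve (q ∷ []))))
    g = proj₁ (onSpine (suc q) (slack (q + 1) (solve (q ∷ []))))

    Xa : X a ≡ 2 * q + 2
    Xa = proj₁ (proj₂ (onSpine (2 * q + 2) ≤-refl))

    Xb : X b ≡ 2 * q + 1
    Xb = proj₁ (proj₂ (onSpine (2 * q + 1) (slack 1 (solve (q ∷ [])))))

    Xh : X h ≡ q × H h ≡ 0
    Xh = proj₂ (onSpine q (slack (q + 2) (solve (q ∷ []))))

    Xg : X g ≡ suc q × H g ≡ 0
    Xg = proj₂ (onSpine (suc q) (slack (q + 1) (solve (q ∷ []))))

    side-right : ∀ u → q < X u → side u ≡ false
    side-right u q<X = dec-false (X u <? suc q) (≤⇒≯ q<X)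

    ℓ-right : ∀ u → q < X u → X u ≤ suc q + ℓ u
    ℓ-right u q<X rewrite contract-right {X u} (≤⇒≯ q<X) =
      ≤-trans (m≤n+∣m-n∣ (X u) (suc q)) (+-monoʳ-≤ (suc q) (m≤m+n _ (H u)))

    q<Xa : q < X a
    q<Xa = subst (q <_) (sym Xa) (slack (q + 1) (solve (q ∷ [])))

    1+q≤ℓa : 1 + q ≤ ℓ a
    1+q≤ℓa = +-cancelˡ-≤ (suc q) (1 + q) (ℓ a)
      (≤-trans (≤-reflexive (trans double (sym Xa))) (ℓ-right a q<Xa))
      where
      double : suc q + (1 + q) ≡ 2 * q + 2
      double = solve (q ∷ [])

    -- `ℓ a` is at least half of `K`, so for two left neighbours `excess-pair` leaves 1 even with
    -- `w` equal to 0.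
    around-a : ∀ {x z} → c x < c a → c a < c z → 1 ≤ excess x a + excess a z
    around-a {x} {z} x<a a<z with half x | half z
    ... | onRight _ sx _ | _ = m≤n⇒m≤n+o _ (same-side x<a (trans sx (sym (side-right a q<Xa))))
    ... | onLeft _ _ _ | onRight _ sz _ = m≤n⇒m≤o+n (excess x a)
      (same-side a<z (trans (side-right a q<Xa) (sym sz)))
    ... | onLeft _ sx _ | onLeft _ sz _ =
      linear 0 (around {x} {a} {z} 0 x<a a<z δ+0≤ ⊞ 1+q≤ℓa ⊞ 1+q≤ℓa)
        (regroup q (ℓ a) (excess x a) (excess a z))
      where
      δ+0≤ : δ x z + 0 ≤ ℓ x + ℓ z
      δ+0≤ = subst (_≤ ℓ x + ℓ z) (sym (+-identityʳ _)) (δ≤ℓ+ℓ x z (trans sx (sym sz)))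
      regroup : ∀ q l e e′ → 1 + (2 * q + 2 + (e + e′) + l + l) + 0
                             ≡ e + e′ + (1 + 0 + 2 * l + (1 + q) + (1 + q))
      regroup = solve-∀

    open Alternation side same-side a around-a public

    ℓ≡0⇒ : ∀ {u} → ℓ u ≡ 0 → u ≡ h ⊎ u ≡ g
    ℓ≡0⇒ {u} ℓ≡0 with half u | ∣m-n∣≡0⇒m≡n (m+n≡0⇒m≡0 _ ℓ≡0) | m+n≡0⇒n≡0 ∣ Y u - suc q ∣ ℓ≡0
    ... | onLeft _ _ Yu | Y≡1+q | H≡0 = inj₁ (XH-injective
      (trans (suc-injective (trans (sym Yu) Y≡1+q)) (sym (proj₁ Xh))) (trans H≡0 (sym (proj₂ Xh))))
    ... | onRight _ _ Yu | Y≡1+q | H≡0 = inj₂ (XH-injective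
      (trans (trans (sym Yu) Y≡1+q) (sym (proj₁ Xg))) (trans H≡0 (sym (proj₂ Xg))))

    ℓh≡0 : ℓ h ≡ 0
    ℓh≡0 rewrite proj₁ Xh | proj₂ Xh | contract-left {q} ≤-refl | ∣n-n∣≡0 q = refl

    ℓg≡0 : ℓ g ≡ 0
    ℓg≡0 rewrite proj₁ Xg | proj₂ Xg | contract-right {suc q} (<-irrefl refl) | ∣n-n∣≡0 q = refl

    h-left : side h ≡ true
    h-left rewrite proj₁ Xh = dec-true (q <? suc q) ≤-refl

    q<Xb : 1 ≤ q → q < X b
    q<Xb 1≤q = subst (q <_) (sym Xb) (slack q (solve (q ∷ [])))

    q≤ℓb : q ≤ ℓ b
    q≤ℓb = +-cancelˡ-≤ (suc q) q (ℓ b)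
      (≤-trans (≤-reflexive (trans double (sym Xb)))
        (ℓ-right b (subst (q <_) (sym Xb) (slack q (solve (q ∷ []))))))
      where
      double : suc q + q ≡ 2 * q + 1
      double = solve (q ∷ [])

    g-right : side g ≡ false
    g-right = side-right g (subst (q <_) (sym (proj₁ Xg)) ≤-refl)

    bound-by-cost : ∀ w →
      (∀ {x xs} → Ascending (x ∷ xs) → length xs ≡ m → (∀ v → v ∈ x ∷ xs) → w ≤ cost x xs) →
      1 + m * K + w + 2 * t ≤ span c + (2 * (q * q) + 6 * q + 4)
    bound-by-cost w w≤cost = begin
      1 + m * K + w + 2 * t
        ≤⟨ +-monoˡ-≤ (2 * t) (span-bound ℓ K c-step w w≤cost) ⟩
      span c + 2 * sum (map ℓ (allFin (suc m))) + 2 * t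
        ≡⟨ +-assoc (span c) _ (2 * t) ⟩
      span c + (2 * sum (map ℓ (allFin (suc m))) + 2 * t)
        ≡⟨ cong (span c +_) 2∑ℓ ⟩
      span c + (2 * (q * q) + 6 * q + 4)
        ∎
      where open ≤-Reasoning

    -- Attained for `t ≡ q`: there the tip shares the column of `h`, and `b` can be visited next to
    -- the tip without any excess.
    subcentral-bound : 1 + m * K + 1 + 2 * t ≤ span c + (2 * (q * q) + 6 * q + 4)
    subcentral-bound = bound-by-cost 1 λ asc _ all∈ → 1≤cost (≤-trans (s≤s z≤n) 1+q≤ℓa) asc (all∈ a)

    module Peripheral (t<q : t < q) where

      1≤q : 1 ≤ q
      1≤q = ≤-trans 1≤t (<⇒≤ t<q)

      -- The place where `t < q`, that is s ≤ k - 2, enters: it keeps the tip out of the column of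
      -- `h`.
      off-centre : ∀ u → side u ≡ true → u ≢ h → X u < q
      off-centre u left u≢h with half u | kind u
      ... | onRight _ right _ | _ = contradiction (trans (sym left) right) λ ()
      ... | onLeft _ _ _ | tip _ Xu _ = subst (_< q) (sym Xu) t<q
      ... | onLeft X≤q _ _ | spine _ _ Hu = ≤∧≢⇒< X≤q λ X≡q →
        u≢h (XH-injective (trans X≡q (sym (proj₁ Xh))) (trans Hu (sym (proj₂ Xh))))

      -- Both vertices lie strictly left of `q`, so measuring each of them to `q` covers the stretch
      -- from the nearer one to `q` twice, and that stretch has length at least 1.
      δ+2≤ℓ+ℓ : ∀ u v → side u ≡ true → side v ≡ true → u ≢ h → v ≢ h → δ u v + 2 ≤ ℓ u + ℓ v
      δ+2≤ℓ+ℓ u v su sv u≢h v≢h with half u | half v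
      ... | onRight _ su′ _ | _ = contradiction (trans (sym su) su′) λ ()
      ... | _ | onRight _ sv′ _ = contradiction (trans (sym sv) sv′) λ ()
      ... | onLeft _ _ Yu | onLeft _ _ Yv rewrite Yu | Yv =
        linear 0 (∣m-n∣+o≤p {X u} {X v} {2} {∣ X u - q ∣ + ∣ X v - q ∣} (apart (X u) (X v) u<q v<q)
                    (subst (X v + 2 ≤_) (cong (X u +_) (+-comm ∣ X v - q ∣ _)) (apart (X v) (X u) v<q u<q))
                  ⊞ ∣m-n∣≤m+n (H u) (H v))
          (regroup ∣ X u - X v ∣ ∣ X u - q ∣ ∣ X v - q ∣ ∣ H u - H v ∣ (H u) (H v))
        where
        u<q = off-centre u su u≢h
        v<q = off-centre v sv v≢h
        apart-arith : ∀ x x′ d d′ q → x < q → q ≤ x′ + d′ → q ≤ x + d → x + 2 ≤ x′ + (d + d′)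
        apart-arith x x′ d d′ q x<q q≤′ q≤ = linear 0 (x<q ⊞ x<q ⊞ q≤′ ⊞ q≤) (identity x x′ d d′ q)
          where
          identity : ∀ x x′ d d′ q → x + 2 + (q + q + (x′ + d′) + (x + d)) + 0
                                     ≡ x′ + (d + d′) + ((1 + x) + (1 + x) + q + q)
          identity = solve-∀
        apart : ∀ x x′ → x < q → x′ < q → x + 2 ≤ x′ + (∣ x - q ∣ + ∣ x′ - q ∣)
        apart x x′ x<q x′<q = apart-arith x x′ ∣ x - q ∣ ∣ x′ - q ∣ q x<q
          (m≤n+∣n-m∣ q x′) (m≤n+∣n-m∣ q x)
        regroup : ∀ d a a′ e p p′ → d + e + 2 + (a + a′ + (p + p′)) + 0
                                    ≡ a + p + (a′ + p′) + (d + 2 + e)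
        regroup = solve-∀

      costly-a : Costly h a 2
      costly-a {x} {z} x<a a<z sx sz x≢h z≢h =
        linear 1 (around {x} {a} {z} 2 x<a a<z (δ+2≤ℓ+ℓ x z sx sz x≢h z≢h) ⊞ 1+q≤ℓa ⊞ 1+q≤ℓa)
          (regroup q (ℓ a) (excess x a) (excess a z))
        where
        regroup : ∀ q l e e′ → 2 + (2 * q + 2 + (e + e′) + l + l) + 1
                               ≡ e + e′ + (1 + 2 + 2 * l + (1 + q) + (1 + q))
        regroup = solve-∀

      -- `ℓ b` is only known to be at least `q`, one less than half of `K`; this takes two of the
      -- three units that `a` would get.
      costly-b : Costly h b 1
      costly-b {x} {z} x<b b<z sx sz x≢h z≢h =
        linear 0 (around {x} {b} {z} 2 x<b b<z (δ+2≤ℓ+ℓ x z sx sz x≢h z≢h) ⊞ q≤ℓb ⊞ q≤ℓb)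
          (regroup q (ℓ b) (excess x b) (excess b z))
        where
        regroup : ∀ q l e e′ → 1 + (2 * q + 2 + (e + e′) + l + l) + 0
                               ≡ e + e′ + (1 + 2 + 2 * l + q + q)
        regroup = solve-∀

      a≢b : a ≢ b
      a≢b a≡b = <-irrefl (trans (sym Xb) (trans (cong X (sym a≡b)) Xa)) Xb<Xa
        where
        Xb<Xa : 2 * q + 1 < 2 * q + 2
        Xb<Xa = slack 0 (solve (q ∷ []))

      bound : 1 + m * K + 2 + 2 * t ≤ span c + (2 * (q * q) + 6 * q + 4)
      bound = bound-by-cost 2 λ asc len → 2≤cost (suc q)
        (≤-trans (s≤s 1≤q) 1+q≤ℓa) (side-right a q<Xa) (≤-trans 1≤q q≤ℓb) (side-right b (q<Xb 1≤q))
        a≢b h-left g-right ℓh≡0 ℓg≡0 ℓ≡0⇒ costly-a costly-b asc (trans len (trans m≡2q+3 length-odd))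
        where
        length-odd : 2 * q + 3 ≡ 1 + 2 * (1 + q)
        length-odd = solve (q ∷ [])

-- The radio numbers

module _ (m t : ℕ) (1≤t : 1 ≤ t) (t+2≤m : t + 2 ≤ m) where

  open Spire m t 1≤t t+2≤m
  open Labelling m

  isRadioNumber : ∀ {M Rs} → Valid t M Rs → (∀ c → IsRadioLabeling S c → M ≤ span c) →
                  IsRadioNumber S M
  isRadioNumber {M} {Rs} valid M≤span = (c , radio , ≤-antisym span≤M (M≤span c radio)) , M≤span
    where
    open Valid valid

    label : ∀ u → ∃ λ l → ⋃ Rs (X u) (H u) l
    label u with kind u
    ... | spine u<m Xu Hu rewrite Xu | Hu = covering u<m
    ... | tip _ Xu Hu     rewrite Xu | Hu = tip-label

    c : V → ℕ
    c u = proj₁ (label u)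

    radio : IsRadioLabeling S c
    radio = (λ u → proj₁ (bounded (proj₂ (label u)))) , λ u v u≢v →
      subst₂ (λ d e → d ≤ e + ∣ c u - c v ∣) (sym diam+1≡m) (sym (dist≡δ u v))
        (compatible .apartness (proj₂ (label u)) (proj₂ (label v)) .Apart.separation
          λ (X≡ , H≡) → u≢v (XH-injective X≡ H≡))

    span≤M : span c ≤ M
    span≤M = s≤s⁻¹ (maxOver-< (s≤s z≤n) λ u → s≤s (proj₂ (bounded (proj₂ (label u)))))

isRadioNumber-odd : ∀ {j t} → 1 ≤ t → t ≤ j →
  IsRadioNumber (spire (suc (2 * j + 2)) (suc t)) (2 + j + j * (1 + 2 * j) + 2 * t)
isRadioNumber-odd {j} {t} 1≤t t≤j =
  isRadioNumber (2 * j + 2) t 1≤t t+2≤m (OddLabelling.valid j t 1≤t t≤j) λ c radio → linear 0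
    (LowerBound.VertexCentred.bound (2 * j + 2) t 1≤t t+2≤m c radio j (j + 2) width t≤j)
    (identity j t (span c))
  where
  t+2≤m : t + 2 ≤ 2 * j + 2
  t+2≤m = linear j t≤j (solve (t ∷ j ∷ []))
  width : 2 * j + 2 ≡ j + (j + 2)
  width = solve (j ∷ [])
  identity : ∀ j t s →
    2 + j + j * (1 + 2 * j) + 2 * t + (s + (j * j + j + (j + 2) * (j + 2) + 2 * (j + 1))) + 0
    ≡ s + (1 + (2 * j + 2) * (2 * j + 2) + 1 + ((j + 2) + 2 * t))
  identity = solve-∀

isRadioNumber-central : ∀ {j} → 1 ≤ j →
  IsRadioNumber (spire (suc (2 * j + 1)) (suc j)) (1 + j + j * (1 + 2 * j))
isRadioNumber-central {j} 1≤j =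
  isRadioNumber (2 * j + 1) j 1≤j t+2≤m (CentralLabelling.valid j 1≤j) λ c radio → linear 0
    (LowerBound.VertexCentred.bound (2 * j + 1) j 1≤j t+2≤m c radio j (j + 1) width ≤-refl)
    (identity j (span c))
  where
  t+2≤m : j + 2 ≤ 2 * j + 1
  t+2≤m = linear 0 1≤j (solve (j ∷ []))
  width : 2 * j + 1 ≡ j + (j + 1)
  width = solve (j ∷ [])
  identity : ∀ j s →
    1 + j + j * (1 + 2 * j) + (s + (j * j + j + (j + 1) * (j + 1) + 2 * (j + 1))) + 0
    ≡ s + (1 + (2 * j + 1) * (2 * j + 1) + 1 + ((j + 1) + 2 * j))
  identity = solve-∀

isRadioNumber-subcentral : ∀ {t} → 1 ≤ t →
  IsRadioNumber (spire (suc (2 * t + 3)) (suc t)) (4 + 3 * t + t * (3 + 2 * t))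
isRadioNumber-subcentral {t} 1≤t =
  isRadioNumber (2 * t + 3) t 1≤t t+2≤m (SubcentralLabelling.valid t) λ c radio → linear 0
    (LowerBound.EdgeCentred.subcentral-bound (2 * t + 3) t 1≤t t+2≤m c radio t refl ≤-refl)
    (identity t (span c))
  where
  t+2≤m : t + 2 ≤ 2 * t + 3
  t+2≤m = slack (1 + t) (solve (t ∷ []))
  identity : ∀ t s →
    4 + 3 * t + t * (3 + 2 * t) + (s + (2 * (t * t) + 6 * t + 4)) + 0
    ≡ s + (1 + (2 * t + 3) * (2 * t + 2) + 1 + 2 * t)
  identity = solve-∀

isRadioNumber-peripheral : ∀ {r t} → 1 ≤ t → t ≤ r →
  IsRadioNumber (spire (suc (2 * r + 5)) (suc t)) (11 + 3 * r + 2 * t + r * (5 + 2 * r))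
isRadioNumber-peripheral {r} {t} 1≤t t≤r =
  isRadioNumber (2 * r + 5) t 1≤t t+2≤m (PeripheralLabelling.valid r t 1≤t t≤r) λ c radio → linear 0
    (LowerBound.EdgeCentred.Peripheral.bound (2 * r + 5) t 1≤t t+2≤m c radio
      (1 + r) width (m≤n⇒m≤1+n t≤r) (s≤s t≤r))
    (identity r t (span c))
  where
  t+2≤m : t + 2 ≤ 2 * r + 5
  t+2≤m = linear (3 + r) t≤r (solve (t ∷ r ∷ []))
  width : 2 * r + 5 ≡ 2 * (1 + r) + 3
  width = solve (r ∷ [])
  identity : ∀ r t s →
    11 + 3 * r + 2 * t + r * (5 + 2 * r) + (s + (2 * ((1 + r) * (1 + r)) + 6 * (1 + r) + 4)) + 0
    ≡ s + (1 + (2 * r + 5) * (2 * (1 + r) + 2) + 2 + 2 * t)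
  identity = solve-∀

mainTheorem1 : (n s : ℕ) → 4 ≤ n → 2 ≤ s → s ≤ n / 2 →
    ((k : ℕ) → n ≡ 2 * k →
    (s + 2 ≤ k → IsRadioNumber (spire n s) (2 * k * k ∸ 4 * k + 2 * s + 3)) ×
    (s + 1 ≡ k → IsRadioNumber (spire n s) (2 * k * k ∸ 2 * k)) ×
    (s ≡ k → IsRadioNumber (spire n s) (2 * k * k ∸ 2 * k + 1))) ×
    ((k : ℕ) → n ≡ 2 * k + 1 →
    IsRadioNumber (spire n s) (2 * k * k ∸ 2 * k + 2 * s))
mainTheorem1 n (suc t) _ (s≤s 1≤t) s≤n/2 =
  (λ k n≡2k → peripheral k n≡2k , subcentral k n≡2k , central k n≡2k) , odd
  where
  cast : ∀ {n′ M M′} → n′ ≡ n → M ≡ M′ →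
         IsRadioNumber (spire n′ (suc t)) M → IsRadioNumber (spire n (suc t)) M′
  cast refl refl r = r

  -- Exhibiting `a` as `b + c` makes the truncated subtraction exact, which leaves semiring
  -- identities.
  ∸-value : ∀ a b c {d e} → a ≡ b + c → e ≡ c + d → e ≡ a ∸ b + d
  ∸-value a b c {d} a≡b+c e≡c+d = trans e≡c+d
    (cong (_+ d) (sym (trans (cong (_∸ b) a≡b+c) (m+n∸m≡n b c))))

  peripheral : ∀ k → n ≡ 2 * k → suc t + 2 ≤ k →
               IsRadioNumber (spire n (suc t)) (2 * k * k ∸ 4 * k + 2 * suc t + 3)
  peripheral k n≡2k s+2≤k with m≤n⇒∃[o]m+o≡n (subst (_≤ k) (+-comm (suc t) 2) s+2≤k)
  ... | o , refl = cast (trans (size t o) (sym n≡2k))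
    (trans (∸-value (2 * (3 + t + o) * (3 + t + o)) (4 * (3 + t + o)) (2 * (3 + t + o) * (1 + t + o))
                    (square t o) (value t o))
           (sym (+-assoc _ (2 * suc t) 3)))
    (isRadioNumber-peripheral 1≤t (m≤m+n t o))
    where
    size : ∀ t o → 1 + (2 * (t + o) + 5) ≡ 2 * (3 + t + o)
    size = solve-∀
    square : ∀ t o → 2 * (3 + t + o) * (3 + t + o) ≡ 4 * (3 + t + o) + 2 * (3 + t + o) * (1 + t + o)
    square = solve-∀
    value : ∀ t o → 11 + 3 * (t + o) + 2 * t + (t + o) * (5 + 2 * (t + o))
                    ≡ 2 * (3 + t + o) * (1 + t + o) + (2 * (1 + t) + 3)
    value = solve-∀

  subcentral : ∀ k → n ≡ 2 * k → suc t + 1 ≡ k → IsRadioNumber (spire n (suc t)) (2 * k * k ∸ 2 * k)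
  subcentral k n≡2k s+1≡k with trans (+-comm 1 (suc t)) s+1≡k
  ... | refl = cast (trans (size t) (sym n≡2k))
    (trans (∸-value (2 * (2 + t) * (2 + t)) (2 * (2 + t)) (2 * (2 + t) * (1 + t)) {0}
                    (square t) (value t))
           (+-identityʳ _))
    (isRadioNumber-subcentral 1≤t)
    where
    size : ∀ t → 1 + (2 * t + 3) ≡ 2 * (2 + t)
    size = solve-∀
    square : ∀ t → 2 * (2 + t) * (2 + t) ≡ 2 * (2 + t) + 2 * (2 + t) * (1 + t)
    square = solve-∀
    value : ∀ t → 4 + 3 * t + t * (3 + 2 * t) ≡ 2 * (2 + t) * (1 + t) + 0
    value = solve-∀

  central : ∀ k → n ≡ 2 * k → suc t ≡ k → IsRadioNumber (spire n (suc t)) (2 * k * k ∸ 2 * k + 1)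
  central k n≡2k refl = cast (trans (size t) (sym n≡2k))
    (∸-value (2 * (1 + t) * (1 + t)) (2 * (1 + t)) (2 * (1 + t) * t) (square t) (value t))
    (isRadioNumber-central 1≤t)
    where
    size : ∀ t → 1 + (2 * t + 1) ≡ 2 * (1 + t)
    size = solve-∀
    square : ∀ t → 2 * (1 + t) * (1 + t) ≡ 2 * (1 + t) + 2 * (1 + t) * t
    square = solve-∀
    value : ∀ t → 1 + t + t * (1 + 2 * t) ≡ 2 * (1 + t) * t + 1
    value = solve-∀

  odd : ∀ k → n ≡ 2 * k + 1 → IsRadioNumber (spire n (suc t)) (2 * k * k ∸ 2 * k + 2 * suc t)
  -- Only 2s ≤ n is kept of the hypothesis on s; for n = 2k + 1 parity still gives s ≤ k, and k = 0
  -- is excluded.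
  odd k n≡2k+1 with ≤-trans (*-monoˡ-≤ 2 s≤n/2) (m/n*n≤m n 2)
  odd zero refl | s≤s ()
  odd (suc j) n≡2k+1 | s*2≤n = cast (trans (size j) (sym n≡2k+1))
    (∸-value (2 * (1 + j) * (1 + j)) (2 * (1 + j)) (2 * (1 + j) * j) (square j) (value j t))
    (isRadioNumber-odd 1≤t (s≤s⁻¹ (≮⇒≥ λ k<s → <-irrefl refl (exceeds k<s))))
    where
    2s≤2k+1 : suc t * 2 ≤ 2 * suc j + 1
    2s≤2k+1 = subst (suc t * 2 ≤_) n≡2k+1 s*2≤n
    exceeds : suc j < suc t → 0 < 0
    exceeds k<s = linear 0 (k<s ⊞ k<s ⊞ 2s≤2k+1) (solve (j ∷ t ∷ []))
    size : ∀ j → 1 + (2 * j + 2) ≡ 2 * (1 + j) + 1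
    size = solve-∀
    square : ∀ j → 2 * (1 + j) * (1 + j) ≡ 2 * (1 + j) + 2 * (1 + j) * j
    square = solve-∀
    value : ∀ j t → 2 + j + j * (1 + 2 * j) + 2 * t ≡ 2 * (1 + j) * j + 2 * (1 + t)
    value = solve-∀
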